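{- Let $n\ge 1$, $1\le k\le n$, and let $\lambda=(\lambda_1,\dots,\lambda_n)$ be a partition with at most $n$ parts (padded with zeros to length $n$). For a $k$-element subset $I=\{i_1<\dots<i_k\}\subseteq\{1,\dots,n\}$ let $D^{I}$ be the $n\times n$ matrix with entries $$D^I_{r,c}=\begin{cases} S_{\lambda_r-r+c}[X^{tq}+X^t] & c\in I,\\ S_{\lambda_r-r+c}[X^{tq}] & c\notin I,\end{cases}\qquad 1\le r,c\le n.$$ Then $$M_k\,S_\lambda[X^{tq}]=\sum_{1\le i_1<\dots<i_k\le n} t^{(n-i_1)+\cdots+(n-i_k)}\,\det D^{\{i_1,\dots,i_k\}}.$$
   Context: Plethystic notation: for a rational function $E$ in $x_1,\dots,x_n,q,t$ with real coefficients and $i\ge1$, $p_i[E]$ is obtained from $E$ by replacing each of $x_1,\dots,x_n,q,t$ by its $i$-th power (coefficients unchanged); for a symmetric function $f$, $f[E]$ is defined by expanding $f$ in the power sums $p_i$. $S_j$ denotes the complete homogeneous symmetric function of degree $j$ ($S_0=1$, $S_j=0$ for $j<0$), and for a partition $\lambda$ with at most $m$ parts, $S_\lambda[E]=\det(S_{\lambda_r-r+c}[E])_{r,c=1}^m$ (Schur function). Put $X=x_1+\cdots+x_n$, $X^{tq}=X(t-1)/(q-1)$, $X^t=X(t-1)$. For $I\subseteq\{1,\dots,n\}$ let $X_I=\sum_{i\in I}x_i$, $X_I^c=\sum_{i\notin I}x_i$, and for alphabets (sums of variables) $A,B$ let $R(A,B)=\prod_{a\in A,b\in B}(a-b)$,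 so $R(tX_I,X_I^c)=\prod_{i\in I,j\notin I}(tx_i-x_j)$. Let $\Theta_l$ be the operator replacing $x_l$ by $qx_l$ (i.e. $f[X]\mapsto f[X+(q-1)x_l]$). The Macdonald operators acting on symmetric functions of $x_1,\dots,x_n$ (with coefficients in $\mathbb{Q}(q,t)$) are $$M_k=t^{\binom k2}\sum_{I=\{i_1,\dots,i_k\}}R(tX_I,X_I^c)\,\Theta_{i_k}\cdots\Theta_{i_1},$$ the sum over all $k$-element subsets $I$ of $\{1,\dots,n\}$.
   Formalization: In M_k the coefficient R(tX_I,X_I^c) is divided by R(X_I,X_I^c); as written the claim fails for n=2, k=1, λ=0. The identity of rational functions is stated as equality of values at all rational x, q, t with distinct x_i and q not a root of unity. -}

module Defs where

open import Data.Nat as ℕ using (ℕ; zero; suc)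
import Data.Nat.Base
open import Data.Integer as ℤ using (ℤ; +_; -[1+_])
open import Data.Rational using (ℚ; 0ℚ; 1ℚ; _+_; _*_; _-_; -_; _÷_; ≢-nonZero)
open import Data.Rational.Properties using (_≟_)
open import Data.Fin using (Fin; zero; suc; toℕ; punchIn)
open import Data.Fin.Subset using (Subset; Side; inside; outside)
open import Data.Vec using (Vec; []; _∷_; lookup)
open import Data.List using (List; []; _∷_; map; _++_; zipWith; foldr)
open import Data.Bool using (if_then_else_)
open import Relation.Nullary using (yes; no)

_^_ : ℚ → ℕ → ℚ
a ^ zero = 1ℚ
a ^ suc m = a * (a ^ m)

-- total division: p / d, defined as 0 when d = 0 (only used where d ≠ 0
-- is guaranteed by hypotheses)
_⊘_ : ℚ → ℚ → ℚ
p ⊘ d with d ≟ 0ℚ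
... | yes _ = 0ℚ
... | no d≢0 = _÷_ p d {{≢-nonZero d≢0}}

fromℕ : ℕ → ℚ
fromℕ m = (+ m) Data.Rational./ 1

ΣF : {n : ℕ} → (Fin n → ℚ) → ℚ
ΣF {zero} f = 0ℚ
ΣF {suc n} f = f zero + ΣF (λ i → f (suc i))

ΠF : {n : ℕ} → (Fin n → ℚ) → ℚ
ΠF {zero} f = 1ℚ
ΠF {suc n} f = f zero * ΠF (λ i → f (suc i))

sumL : List ℚ → ℚ
sumL = foldr _+_ 0ℚ

det : {n : ℕ} → (Fin n → Fin n → ℚ) → ℚ
det {zero} M = 1ℚ
det {suc n} M =
  ΣF (λ c → (((- 1ℚ) ^ toℕ c) * M zero c) * det (λ r c' → M (suc r) (punchIn c c')))

-- Plethystic alphabets, represented by the values of their power sums: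
-- an alphabet E is given by  p : ℕ → ℚ  with  p i = p_i[E]  (only i ≥ 1 used).

Alph : Set
Alph = ℕ → ℚ

_⊕_ : Alph → Alph → Alph
(A ⊕ B) i = A i + B i

-- [S_j[E], S_{j-1}[E], …, S_0[E]] computed by Newton's identity
--   j S_j = Σ_{i=1}^{j} p_i S_{j-i}
-- (this is the expansion of S_j in power sums).
hsRev : Alph → ℕ → List ℚ
hsRev E zero = 1ℚ ∷ []
hsRev E (suc j) =
  (sumL (zipWith _*_ (map (λ i → E (suc i)) (upTo (suc j))) (hsRev E j)) ⊘ fromℕ (suc j))
  ∷ hsRev E j
  where
  upTo : ℕ → List ℕ
  upTo zero = []
  upTo (suc m) = upTo m ++ (m ∷ [])

S : ℕ → Alph → ℚ
S j E with hsRev E j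
... | [] = 0ℚ
... | h ∷ _ = h

Sℤ : ℤ → Alph → ℚ
Sℤ (+ j) E = S j E
Sℤ -[1+ j ] E = 0ℚ

-- index λ_r - r + c (rows/columns 1-based in the paper; here 0-based,
-- which gives the same difference)
idx : {n : ℕ} → (Fin n → ℕ) → Fin n → Fin n → ℤ
idx lam r c = ((+ lam r) ℤ.- (+ toℕ r)) ℤ.+ (+ toℕ c)

Schur : {n : ℕ} → (Fin n → ℕ) → Alph → ℚ
Schur lam E = det (λ r c → Sℤ (idx lam r c) E)

-- Evaluation at a point (x₁,…,xₙ,q,t) ∈ ℚⁿ⁺²

pX : {n : ℕ} → (Fin n → ℚ) → ℕ → ℚ
pX x i = ΣF (λ j → x j ^ i)

-- X^{tq} = X (t-1)/(q-1)
Xtq : {n : ℕ} → (Fin n → ℚ) → ℚ → ℚ → Alph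
Xtq x q t i = (pX x i * ((t ^ i) - 1ℚ)) ⊘ ((q ^ i) - 1ℚ)

-- X^t = X (t-1)
Xt : {n : ℕ} → (Fin n → ℚ) → ℚ → Alph
Xt x t i = pX x i * ((t ^ i) - 1ℚ)

allSubsets : (n : ℕ) → List (Subset n)
allSubsets zero = [] ∷ []
allSubsets (suc n) = map (inside ∷_) (allSubsets n) ++ map (outside ∷_) (allSubsets n)

ΣSub : (n k : ℕ) → (Subset n → ℚ) → ℚ
ΣSub n k f = sumL (map (λ I → if Data.Nat.Base._≡ᵇ_ (Data.Fin.Subset.∣ I ∣) k then f I else 0ℚ)
                       (allSubsets n))

ΘI : {n : ℕ} → Subset n → ℚ → (Fin n → ℚ) → (Fin n → ℚ)
ΘI I q x i with lookup I i
... | inside = q * x i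
... | outside = x i

RI : {n : ℕ} → Subset n → ℚ → (Fin n → ℚ) → ℚ
RI I t x = ΠF (λ i → ΠF (λ j → factor (lookup I i) (lookup I j) i j))
  where
  factor : Side → Side → _ → _ → ℚ
  factor inside outside i j = (t * x i) - x j
  factor _ _ _ _ = 1ℚ

-- coefficient of the Macdonald operator: R(tX_I, X_I^c) / R(X_I, X_I^c)
-- (the quotient by R(X_I,X_I^c) is the standard
-- Macdonald normalisation; without it the statement is false)
AI : {n : ℕ} → Subset n → ℚ → (Fin n → ℚ) → ℚ
AI I t x = RI I t x ⊘ RI I 1ℚ x

Mk : (n k : ℕ) → ℚ → ℚ → ((Fin n → ℚ) → ℚ) → (Fin n → ℚ) → ℚ
Mk n k q t F x = (t ^ (k ℕ.* (k ℕ.∸ 1) ℕ./ 2)) *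
  ΣSub n k (λ I → AI I t x * F (ΘI I q x))

DI : {n : ℕ} → (Fin n → ℕ) → Subset n → (Fin n → ℚ) → ℚ → ℚ → Fin n → Fin n → ℚ
DI lam I x q t r c with lookup I c
... | inside = Sℤ (idx lam r c) (Xtq x q t ⊕ Xt x t)
... | outside = Sℤ (idx lam r c) (Xtq x q t)

-- exponent Σ_{i ∈ I} (n - i)  (i 1-based; with 0-based i this is n - 1 - i)
expI : {n : ℕ} → Subset n → ℕ
expI {n} I = sumN (λ i → term (lookup I i) i)
  where
  term : Side → Fin n → ℕ
  term inside i = n ℕ.∸ suc (toℕ i)
  term outside i = 0
  sumN : {m : ℕ} → (Fin m → ℕ) → ℕ
  sumN {zero} f = 0
  sumN {suc m} f = f zero ℕ.+ sumN (λ i → f (suc i))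

{-# OPTIONS --safe #-}
-- A row of each determinant is a linear functional G_r on polynomials in w (w shifts the index of S), and
-- every alphabet that occurs arises from X^{tq} + tX by removing n variables, that is, by multiplying with n
-- linear factors. Multiply the identities for all k by u^k and add them up. The right-hand side becomes the
-- determinant of the functionals
--   f ↦ G_r (f(w) ∏ (w - t x_i) + u t^(n-1) f(w/t) ∏ (w - x_i))
-- at f = 1, w, …, w^(n-1). Passing to the basis f_j = ∏_{i ≠ j} (w - x_i) multiplies it by the Vandermonde
-- product of x, and turns the argument of G_r into
--   ((w - t x_j) + u (w - x_j)) ∏_{i ≠ j} (w - x_i) (w - t x_i).
-- Expand the determinant in the two summands w - t x_j (j ∉ I) and u (w - x_j) (j ∈ I). In the term of I the
-- factor ∏_{i ∈ I} (w - x_i) ∏_{i ∉ I} (w - t x_i) splits off, which belongs to the alphabet of Θ_I on the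
-- left-hand side, and there remains the basis f_j formed with y_i = t x_i for i ∈ I and y_i = x_i otherwise.
-- The quotient of the Vandermonde products of y and x is t^(k(k-1)/2) R(tX_I, X_I^c) / R(X_I, X_I^c).
module Submission where

open import Defs
open import Data.Bool using (true; false; T; if_then_else_)
open import Data.Bool.Properties using (if-float)
import Data.Fin
open import Data.Fin using (Fin; zero; suc; toℕ; fromℕ<; punchIn)
open import Data.Fin.Properties using (toℕ-fromℕ<; suc-injective)
open import Data.Fin.Subset using (Subset; Side; inside; outside; ∣_∣)
open import Data.Fin.Subset.Properties using (∣p∣≤n)
open import Data.Integer as ℤ using (ℤ; -[1+_])
import Data.Integer.Properties as ℤ
open import Data.Integer.Tactic.RingSolver using () renaming (solve-∀ to ℤ-solve-∀)
open import Data.List using (List; []; _∷_; map; _++_; length; tabulate; zipWith; upTo; applyUpTo)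
open import Data.List.Properties using (length-tabulate; map-tabulate; upTo-∷ʳ; map-upTo)
open import Data.List.Relation.Binary.Permutation.Propositional as ↭ using (_↭_)
open import Data.List.Relation.Binary.Permutation.Propositional.Properties
  using (shift; ++⁺ˡ; ++⁺ʳ; ++-comm; drop-∷)
open import Data.Maybe using (Maybe; just; nothing)
open import Data.Nat as ℕ using (ℕ; zero; suc; _≤_)
open import Data.Nat.DivMod using (m*n/n≡m)
import Data.Nat.Properties as ℕ
open import Data.Nat.Tactic.RingSolver using () renaming (solve-∀ to ℕ-solve-∀)
open import Data.Product using (∃; _,_)
open import Data.Rational using (ℚ; 0ℚ; 1ℚ; ½; _+_; _*_; _-_; -_; 1/_; NonZero; Positive; ≢-nonZero; toℚᵘ)
open import Data.Rational.Properties using (+-*-commutativeRing; _≟_; +-identityˡ; +-identityʳ; *-zeroˡ; *-zeroʳ;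
  *-identityˡ; *-inverseˡ; toℚᵘ-injective; toℚᵘ-fromℚᵘ; toℚᵘ-homo-+; normalize-pos)
open import Data.Rational.Unnormalised using (mkℚᵘ; *≡*)
import Data.Rational.Unnormalised.Properties as ℚᵘ
open import Data.Sum using (inj₁; inj₂)
open import Data.Vec using (lookup; _∷_; [])
open import Function using (_∘_)
open import Level using (0ℓ)
open import Relation.Binary.PropositionalEquality
open import Relation.Nullary using (yes; no; contradiction)
open import Tactic.RingSolver using (solve-∀)
open import Tactic.RingSolver.Core.AlmostCommutativeRing using (AlmostCommutativeRing; fromCommutativeRing)
open ≡-Reasoning

-- The zero test lets the solver drop monomials whose coefficients cancel.
ℚ-ring : AlmostCommutativeRing 0ℓ 0ℓ
ℚ-ring = fromCommutativeRing +-*-commutativeRing isZero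
  where
  isZero : ∀ x → Maybe (0ℚ ≡ x)
  isZero x with 0ℚ ≟ x
  ... | yes p = just p
  ... | no _ = nothing

-- Finite sums and products

ΣF-cong : ∀ {n} {f g : Fin n → ℚ} → (∀ i → f i ≡ g i) → ΣF f ≡ ΣF g
ΣF-cong {zero} e = refl
ΣF-cong {suc n} e = cong₂ _+_ (e zero) (ΣF-cong (e ∘ suc))

ΣF-zero : ∀ {n} {f : Fin n → ℚ} → (∀ i → f i ≡ 0ℚ) → ΣF f ≡ 0ℚ
ΣF-zero {zero} e = refl
ΣF-zero {suc n} e = cong₂ _+_ (e zero) (ΣF-zero (e ∘ suc))

+-interchange : ∀ a b c d → (a + b) + (c + d) ≡ (a + c) + (b + d)
+-interchange = solve-∀ ℚ-ring

ΣF-+ : ∀ {n} (f g : Fin n → ℚ) → ΣF (λ i → f i + g i) ≡ ΣF f + ΣF g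
ΣF-+ {zero} f g = refl
ΣF-+ {suc n} f g = trans (cong ((f zero + g zero) +_) (ΣF-+ (f ∘ suc) (g ∘ suc)))
  (+-interchange (f zero) (g zero) (ΣF (f ∘ suc)) (ΣF (g ∘ suc)))

*-distribˡ-ΣF : ∀ {n} k (f : Fin n → ℚ) → k * ΣF f ≡ ΣF (λ i → k * f i)
*-distribˡ-ΣF {zero} k f = *-zeroʳ k
*-distribˡ-ΣF {suc n} k f = trans (distrib k (f zero) (ΣF (f ∘ suc))) (cong (k * f zero +_) (*-distribˡ-ΣF k (f ∘ suc)))
  where
  distrib : ∀ k a b → k * (a + b) ≡ k * a + k * b
  distrib = solve-∀ ℚ-ring

ΣF-swap : ∀ {m n} (f : Fin m → Fin n → ℚ) → ΣF (λ i → ΣF (f i)) ≡ ΣF (λ j → ΣF (λ i → f i j))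
ΣF-swap {zero} {n} f = sym (ΣF-zero {n} (λ _ → refl))
ΣF-swap {suc m} f = trans (cong (ΣF (f zero) +_) (ΣF-swap (f ∘ suc))) (sym (ΣF-+ (f zero) (λ j → ΣF (λ i → f (suc i) j))))

ΠF-cong : ∀ {n} {f g : Fin n → ℚ} → (∀ i → f i ≡ g i) → ΠF f ≡ ΠF g
ΠF-cong {zero} e = refl
ΠF-cong {suc n} e = cong₂ _*_ (e zero) (ΠF-cong (e ∘ suc))

ΠF-* : ∀ {n} (f g : Fin n → ℚ) → ΠF (λ i → f i * g i) ≡ ΠF f * ΠF g
ΠF-* {zero} f g = refl
ΠF-* {suc n} f g = trans (cong ((f zero * g zero) *_) (ΠF-* (f ∘ suc) (g ∘ suc)))
  (interchange (f zero) (g zero) (ΠF (f ∘ suc)) (ΠF (g ∘ suc)))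
  where
  interchange : ∀ a b c d → (a * b) * (c * d) ≡ (a * c) * (b * d)
  interchange = solve-∀ ℚ-ring

sumOver : ∀ {A : Set} → List A → (A → ℚ) → ℚ
sumOver xs f = sumL (map f xs)

module _ {A : Set} where

  sumOver-cong : (xs : List A) {f g : A → ℚ} → (∀ x → f x ≡ g x) → sumOver xs f ≡ sumOver xs g
  sumOver-cong [] e = refl
  sumOver-cong (x ∷ xs) e = cong₂ _+_ (e x) (sumOver-cong xs e)

  sumOver-+ : (xs : List A) (f g : A → ℚ) → sumOver xs (λ x → f x + g x) ≡ sumOver xs f + sumOver xs g
  sumOver-+ [] f g = refl
  sumOver-+ (x ∷ xs) f g = trans (cong ((f x + g x) +_) (sumOver-+ xs f g))
    (+-interchange (f x) (g x) (sumOver xs f) (sumOver xs g))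

  *-distribˡ-sumOver : ∀ k (xs : List A) (f : A → ℚ) → k * sumOver xs f ≡ sumOver xs (λ x → k * f x)
  *-distribˡ-sumOver k [] f = *-zeroʳ k
  *-distribˡ-sumOver k (x ∷ xs) f = trans (distrib k (f x) (sumOver xs f)) (cong (k * f x +_) (*-distribˡ-sumOver k xs f))
    where
    distrib : ∀ k a b → k * (a + b) ≡ k * a + k * b
    distrib = solve-∀ ℚ-ring

  sumOver-++ : (xs ys : List A) (f : A → ℚ) → sumOver (xs ++ ys) f ≡ sumOver xs f + sumOver ys f
  sumOver-++ [] ys f = sym (+-identityˡ (sumOver ys f))
  sumOver-++ (x ∷ xs) ys f = trans (cong (f x +_) (sumOver-++ xs ys f)) (assoc (f x) (sumOver xs f) (sumOver ys f))
    where
    assoc : ∀ a b c → a + (b + c) ≡ (a + b) + c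
    assoc = solve-∀ ℚ-ring

  ΣF-sumOver-swap : ∀ {n} (xs : List A) (f : Fin n → A → ℚ) →
    ΣF (λ i → sumOver xs (f i)) ≡ sumOver xs (λ x → ΣF (λ i → f i x))
  ΣF-sumOver-swap {n} [] f = ΣF-zero {n} (λ _ → refl)
  ΣF-sumOver-swap (x ∷ xs) f = trans (ΣF-+ (λ i → f i x) (λ i → sumOver xs (f i))) (cong (ΣF (λ i → f i x) +_) (ΣF-sumOver-swap xs f))

sumOver-map : ∀ {A B : Set} (h : A → B) (xs : List A) (f : B → ℚ) → sumOver (map h xs) f ≡ sumOver xs (f ∘ h)
sumOver-map h [] f = refl
sumOver-map h (x ∷ xs) f = cong (f (h x) +_) (sumOver-map h xs f)

sumOver-subsets : ∀ n (f : Subset (suc n) → ℚ) → sumOver (allSubsets (suc n)) f ≡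
  sumOver (allSubsets n) (f ∘ (inside ∷_)) + sumOver (allSubsets n) (f ∘ (outside ∷_))
sumOver-subsets n f = trans (sumOver-++ (map (inside ∷_) (allSubsets n)) _ f)
  (cong₂ _+_ (sumOver-map _ (allSubsets n) f) (sumOver-map _ (allSubsets n) f))

-- Determinants

sgn : ∀ {n} → Fin n → ℚ
sgn c = (- 1ℚ) ^ toℕ c

det-cong : ∀ {n} {M N : Fin n → Fin n → ℚ} → (∀ i j → M i j ≡ N i j) → det M ≡ det N
det-cong {zero} e = refl
det-cong {suc n} e = ΣF-cong λ c →
  cong₂ (λ m d → (sgn c * m) * d) (e zero c) (det-cong λ i j → e (suc i) (punchIn c j))

infixr 5 _▹_

-- Row and column counts are independent, since deleting a column acts on blocks of any height. A
-- matrix and its reassembly from rows agree only entrywise, so regrouping rows goes through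
-- `det-cong`.
_▹_ : ∀ {m n} → (Fin n → ℚ) → (Fin m → Fin n → ℚ) → Fin (suc m) → Fin n → ℚ
(v ▹ M) zero = v
(v ▹ M) (suc i) = M i

▹-cong : ∀ {m n} {v w : Fin n → ℚ} {M N : Fin m → Fin n → ℚ} → (∀ j → v j ≡ w j) →
  (∀ i j → M i j ≡ N i j) → ∀ i j → (v ▹ M) i j ≡ (w ▹ N) i j
▹-cong e f zero j = e j
▹-cong e f (suc i) j = f i j

▹-congˡ : ∀ {m n} (M : Fin m → Fin n → ℚ) {v w : Fin n → ℚ} →
  (∀ j → v j ≡ w j) → ∀ i j → (v ▹ M) i j ≡ (w ▹ M) i j
▹-congˡ M e = ▹-cong e (λ _ _ → refl)

▹-congʳ : ∀ {m n} (v : Fin n → ℚ) {M N : Fin m → Fin n → ℚ} →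
  (∀ i j → M i j ≡ N i j) → ∀ i j → (v ▹ M) i j ≡ (v ▹ N) i j
▹-congʳ v f = ▹-cong (λ _ → refl) f

head-▹-tail : ∀ {m n} (R : Fin (suc m) → Fin n → ℚ) i j → R i j ≡ (R zero ▹ R ∘ suc) i j
head-▹-tail R zero j = refl
head-▹-tail R (suc i) j = refl

minorOf : ∀ {m n} → (Fin m → Fin (suc n) → ℚ) → Fin (suc n) → Fin m → Fin n → ℚ
minorOf M c i j = M i (punchIn c j)

minorOf-▹ : ∀ {m n} (v : Fin (suc n) → ℚ) (M : Fin m → Fin (suc n) → ℚ) c i j →
  minorOf (v ▹ M) c i j ≡ (v ∘ punchIn c ▹ minorOf M c) i j
minorOf-▹ v M c zero j = refl
minorOf-▹ v M c (suc i) j = refl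

-- Expansion along the top row is linear in the minors. The factor k is a sign in `det-rotate`, zero
-- in `det-repeated-row` and a product of differences in `det-others`.
det-▹-scale : ∀ {n} k (v : Fin (suc n) → ℚ) (M N : Fin n → Fin (suc n) → ℚ) →
  (∀ c → det (minorOf M c) ≡ k * det (minorOf N c)) → det (v ▹ M) ≡ k * det (v ▹ N)
det-▹-scale k v M N e = begin
  det (v ▹ M)                                              ≡⟨ ΣF-cong (λ c → trans (cong (sgn c * v c *_) (e c)) (pull (sgn c * v c) k (det (minorOf N c)))) ⟩
  ΣF (λ c → k * (sgn c * v c * det (minorOf N c)))         ≡⟨ *-distribˡ-ΣF k (λ c → sgn c * v c * det (minorOf N c)) ⟨
  k * det (v ▹ N)                                          ∎
  where
  pull : ∀ a k d → a * (k * d) ≡ k * (a * d)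
  pull = solve-∀ ℚ-ring

det-▹-cong : ∀ {n} (v : Fin (suc n) → ℚ) (M N : Fin n → Fin (suc n) → ℚ) →
  (∀ c → det (minorOf M c) ≡ det (minorOf N c)) → det (v ▹ M) ≡ det (v ▹ N)
det-▹-cong v M N e = ΣF-cong λ c → cong (sgn c * v c *_) (e c)

det-▹-linear : ∀ {n} k (v w : Fin (suc n) → ℚ) (M : Fin n → Fin (suc n) → ℚ) →
  det ((λ j → v j + k * w j) ▹ M) ≡ det (v ▹ M) + k * det (w ▹ M)
det-▹-linear k v w M = begin
  det ((λ j → v j + k * w j) ▹ M)                               ≡⟨ ΣF-cong (λ c → split (sgn c) (v c) k (w c) (det (minorOf M c))) ⟩
  ΣF (λ c → sgn c * v c * det (minorOf M c) + k * (sgn c * w c * det (minorOf M c)))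
                                                                ≡⟨ ΣF-+ (λ c → sgn c * v c * det (minorOf M c)) (λ c → k * (sgn c * w c * det (minorOf M c))) ⟩
  det (v ▹ M) + ΣF (λ c → k * (sgn c * w c * det (minorOf M c))) ≡⟨ cong (det (v ▹ M) +_) (*-distribˡ-ΣF k (λ c → sgn c * w c * det (minorOf M c))) ⟨
  det (v ▹ M) + k * det (w ▹ M)                                 ∎
  where
  split : ∀ s v k w d → s * (v + k * w) * d ≡ s * v * d + k * (s * w * d)
  split = solve-∀ ℚ-ring

-- Both expansions share the term of the corner entry. In the other terms of the row expansion each
-- minor is expanded along its first column; interchanging the two sums gives the column expansion.
det-column-expansion : ∀ {n} (M : Fin (suc n) → Fin (suc n) → ℚ) →
  det M ≡ ΣF (λ r → sgn r * M r zero * det (λ i j → M (punchIn r i) (suc j)))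
det-column-expansion {zero} M = refl
det-column-expansion {suc n} M = cong (1ℚ * M zero zero * det (λ i j → M (suc i) (suc j)) +_) (begin
  ΣF (λ c → - 1ℚ * sgn c * M zero (suc c) * det (λ i j → M (suc i) (punchIn (suc c) j)))
    ≡⟨ ΣF-cong (λ c → trans (cong (- 1ℚ * sgn c * M zero (suc c) *_) (det-column-expansion (λ i j → M (suc i) (punchIn (suc c) j))))
         (*-distribˡ-ΣF (- 1ℚ * sgn c * M zero (suc c)) (λ r → sgn r * M (suc r) zero * D r c))) ⟩
  ΣF (λ c → ΣF (λ r → - 1ℚ * sgn c * M zero (suc c) * (sgn r * M (suc r) zero * D r c)))
    ≡⟨ ΣF-swap (λ c r → - 1ℚ * sgn c * M zero (suc c) * (sgn r * M (suc r) zero * D r c)) ⟩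
  ΣF (λ r → ΣF (λ c → - 1ℚ * sgn c * M zero (suc c) * (sgn r * M (suc r) zero * D r c)))
    ≡⟨ ΣF-cong (λ r → trans (ΣF-cong (λ c → exchange (- 1ℚ) (sgn c) (M zero (suc c)) (sgn r) (M (suc r) zero) (D r c)))
         (sym (*-distribˡ-ΣF (- 1ℚ * sgn r * M (suc r) zero) (λ c → sgn c * M zero (suc c) * D r c)))) ⟩
  ΣF (λ r → - 1ℚ * sgn r * M (suc r) zero * det (λ i j → M (punchIn (suc r) i) (suc j))) ∎)
  where
  D : Fin (suc n) → Fin (suc n) → ℚ
  D r c = det (λ i j → M (suc (punchIn r i)) (suc (punchIn c j)))
  exchange : ∀ e s a t b d → e * s * a * (t * b * d) ≡ e * t * b * (s * a * d)
  exchange = solve-∀ ℚ-ring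

det-transpose : ∀ {n} (M : Fin n → Fin n → ℚ) → det M ≡ det (λ i j → M j i)
det-transpose {zero} M = refl
det-transpose {suc n} M = sym (trans (det-column-expansion (λ i j → M j i))
  (ΣF-cong λ c → cong (sgn c * M zero c *_) (sym (det-transpose (λ i j → M (suc i) (punchIn c j))))))

-- Alternation and row operations

lift : ∀ {m n} → (Fin m → Fin n) → Fin (suc m) → Fin (suc n)
lift e zero = zero
lift e (suc i) = suc (e i)

-- The expansion of det (a ▹ b ▹ M) along its first two rows, with the determinant
-- of the columns of M selected by e replaced by an arbitrary function K of e.
twoRows : ∀ {n} → (a b : Fin (suc (suc n)) → ℚ) → ((Fin n → Fin (suc (suc n))) → ℚ) → ℚ
twoRows a b K = ΣF (λ c → sgn c * a c * ΣF (λ d → sgn d * b (punchIn c d) * K (λ i → punchIn c (punchIn d i))))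

module _ {n} (K : (Fin n → Fin (suc (suc n))) → ℚ) where

  cross : (a b : Fin (suc (suc n)) → ℚ) → ℚ
  cross a b = a zero * ΣF (λ d → sgn d * b (suc d) * K (λ i → suc (punchIn d i)))

  -- Pairs of columns are sorted by their use of column 0: by the row a (`cross a b`), by the row b
  -- (`cross b a`, with the opposite sign), or by neither. In the last group the sign in the
  -- hypothesis cancels the sign of the outer sum.
  twoRows-split : ∀ a b (R : Fin (suc n) → ℚ) →
    (∀ c → ΣF (λ d → sgn (suc d) * b (suc (punchIn c d)) * K (λ i → punchIn (suc c) (punchIn (suc d) i))) ≡ - R c) →
    twoRows a b K ≡ cross a b - cross b a + ΣF (λ c → sgn c * a (suc c) * R c)
  twoRows-split a b R e = begin
    1ℚ * a zero * X + ΣF (λ c → - 1ℚ * sgn c * a (suc c) * (1ℚ * b zero * k c + Z c))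
      ≡⟨ cong (1ℚ * a zero * X +_) (ΣF-cong λ c → trans (cong (λ r → - 1ℚ * sgn c * a (suc c) * (1ℚ * b zero * k c + r)) (e c))
                     (expand (sgn c) (a (suc c)) (b zero) (k c) (R c))) ⟩
    1ℚ * a zero * X + ΣF (λ c → (- b zero) * (sgn c * a (suc c) * k c) + sgn c * a (suc c) * R c)
      ≡⟨ cong (1ℚ * a zero * X +_) (ΣF-+ (λ c → (- b zero) * (sgn c * a (suc c) * k c)) (λ c → sgn c * a (suc c) * R c)) ⟩
    1ℚ * a zero * X + (ΣF (λ c → (- b zero) * (sgn c * a (suc c) * k c)) + W)
      ≡⟨ cong (λ y → 1ℚ * a zero * X + (y + W)) (*-distribˡ-ΣF (- b zero) (λ c → sgn c * a (suc c) * k c)) ⟨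
    1ℚ * a zero * X + ((- b zero) * Y + W)
      ≡⟨ collect (a zero) X (b zero) Y W ⟩
    cross a b - cross b a + W ∎
    where
    k : Fin (suc n) → ℚ
    k c = K (λ i → suc (punchIn c i))
    Z : Fin (suc n) → ℚ
    Z c = ΣF (λ d → sgn (suc d) * b (suc (punchIn c d)) * K (λ i → punchIn (suc c) (punchIn (suc d) i)))
    X Y W : ℚ
    X = ΣF (λ d → sgn d * b (suc d) * k d)
    Y = ΣF (λ c → sgn c * a (suc c) * k c)
    W = ΣF (λ c → sgn c * a (suc c) * R c)
    expand : ∀ s a b k r → - 1ℚ * s * a * (1ℚ * b * k + - r) ≡ (- b) * (s * a * k) + s * a * r
    expand = solve-∀ ℚ-ring
    collect : ∀ a x b y t → 1ℚ * a * x + ((- b) * y + t) ≡ a * x - b * y + t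
    collect = solve-∀ ℚ-ring

-- The two `cross` terms trade places when a and b do, and the pairs avoiding column 0 form a
-- `twoRows` with one column fewer. With two columns in all there are no such pairs. K has to
-- respect pointwise equality because the compositions of `punchIn` agree only pointwise.
twoRows-antisym : ∀ {n} (K : (Fin n → Fin (suc (suc n))) → ℚ) →
  (∀ {e e′} → (∀ i → e i ≡ e′ i) → K e ≡ K e′) → ∀ a b → twoRows a b K ≡ - twoRows b a K
twoRows-antisym {zero} K K-cong a b = begin
  twoRows a b K                          ≡⟨ twoRows-split K a b (λ _ → 0ℚ) (λ _ → refl) ⟩
  cross K a b - cross K b a + ΣF T₁      ≡⟨ cong (cross K a b - cross K b a +_) (ΣF-zero {f = T₁} (λ c → *-zeroʳ (sgn c * a (suc c)))) ⟩
  cross K a b - cross K b a + 0ℚ         ≡⟨ flip (cross K a b) (cross K b a) ⟩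
  - (cross K b a - cross K a b + 0ℚ)     ≡⟨ cong (λ t → - (cross K b a - cross K a b + t)) (ΣF-zero {f = T₂} (λ c → *-zeroʳ (sgn c * b (suc c)))) ⟨
  - (cross K b a - cross K a b + ΣF T₂)  ≡⟨ cong -_ (twoRows-split K b a (λ _ → 0ℚ) (λ _ → refl)) ⟨
  - twoRows b a K                        ∎
  where
  T₁ T₂ : Fin 1 → ℚ
  T₁ c = sgn c * a (suc c) * 0ℚ
  T₂ c = sgn c * b (suc c) * 0ℚ
  flip : ∀ x y → x - y + 0ℚ ≡ - (y - x + 0ℚ)
  flip = solve-∀ ℚ-ring
twoRows-antisym {suc n} K K-cong a b = begin
  twoRows a b K                                                      ≡⟨ twoRows-split K a b _ (rest b) ⟩
  cross K a b - cross K b a + twoRows (a ∘ suc) (b ∘ suc) K′         ≡⟨ cong (cross K a b - cross K b a +_)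
                                                                          (twoRows-antisym K′ K′-cong (a ∘ suc) (b ∘ suc)) ⟩
  cross K a b - cross K b a + - twoRows (b ∘ suc) (a ∘ suc) K′       ≡⟨ flip (cross K a b) (cross K b a) _ ⟩
  - (cross K b a - cross K a b + twoRows (b ∘ suc) (a ∘ suc) K′)     ≡⟨ cong -_ (twoRows-split K b a _ (rest a)) ⟨
  - twoRows b a K                                                    ∎
  where
  K′ : (Fin n → Fin (suc (suc n))) → ℚ
  -- Column 0, used by neither row, is the first of the columns left to K.
  K′ e = K (lift e)
  lift-cong : ∀ {e e′ : Fin n → Fin (suc (suc n))} → (∀ i → e i ≡ e′ i) → ∀ i → lift e i ≡ lift e′ i
  lift-cong p zero = refl
  lift-cong p (suc i) = cong suc (p i)
  K′-cong : ∀ {e e′} → (∀ i → e i ≡ e′ i) → K′ e ≡ K′ e′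
  K′-cong p = K-cong (lift-cong p)
  punch-lift : ∀ (c : Fin (suc (suc n))) (d : Fin (suc n)) i →
    punchIn (suc c) (punchIn (suc d) i) ≡ lift (λ i → punchIn c (punchIn d i)) i
  punch-lift c d zero = refl
  punch-lift c d (suc i) = refl
  neg : ∀ s b k → - 1ℚ * s * b * k ≡ - 1ℚ * (s * b * k)
  neg = solve-∀ ℚ-ring
  neg′ : ∀ x → - 1ℚ * x ≡ - x
  neg′ = solve-∀ ℚ-ring
  rest : ∀ b c → ΣF (λ d → sgn (suc d) * b (suc (punchIn c d)) * K (λ i → punchIn (suc c) (punchIn (suc d) i)))
    ≡ - ΣF (λ d → sgn d * b (suc (punchIn c d)) * K′ (λ i → punchIn c (punchIn d i)))
  rest b c = begin
    ΣF (λ d → sgn (suc d) * b (suc (punchIn c d)) * K (λ i → punchIn (suc c) (punchIn (suc d) i)))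
      ≡⟨ ΣF-cong (λ d → trans (cong (sgn (suc d) * b (suc (punchIn c d)) *_) (K-cong (punch-lift c d))) (neg (sgn d) _ _)) ⟩
    ΣF (λ d → - 1ℚ * (sgn d * b (suc (punchIn c d)) * K′ (λ i → punchIn c (punchIn d i))))
      ≡⟨ *-distribˡ-ΣF (- 1ℚ) (λ d → sgn d * b (suc (punchIn c d)) * K′ (λ i → punchIn c (punchIn d i))) ⟨
    - 1ℚ * ΣF (λ d → sgn d * b (suc (punchIn c d)) * K′ (λ i → punchIn c (punchIn d i)))
      ≡⟨ neg′ _ ⟩
    - ΣF (λ d → sgn d * b (suc (punchIn c d)) * K′ (λ i → punchIn c (punchIn d i))) ∎
  flip : ∀ x y z → x - y + - z ≡ - (y - x + z)
  flip = solve-∀ ℚ-ring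

-- Two successive row expansions make the determinant a `twoRows` by computation, K being the
-- determinant of the remaining columns of M.
det-swap : ∀ {n} (a b : Fin (suc (suc n)) → ℚ) (M : Fin n → Fin (suc (suc n)) → ℚ) →
  det (a ▹ b ▹ M) ≡ - det (b ▹ a ▹ M)
det-swap a b M = twoRows-antisym (λ e → det (λ i j → M i (e j))) (λ p → det-cong λ i j → cong (M i) (p j)) a b

det-repeated : ∀ {n} (a : Fin (suc (suc n)) → ℚ) (M : Fin n → Fin (suc (suc n)) → ℚ) → det (a ▹ a ▹ M) ≡ 0ℚ
det-repeated a M = begin
  det (a ▹ a ▹ M)                                ≡⟨ halves (det (a ▹ a ▹ M)) ⟩
  ½ * (det (a ▹ a ▹ M) + det (a ▹ a ▹ M))        ≡⟨ cong (λ d → ½ * (det (a ▹ a ▹ M) + d)) (det-swap a a M) ⟩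
  ½ * (det (a ▹ a ▹ M) + - det (a ▹ a ▹ M))      ≡⟨ cancel (det (a ▹ a ▹ M)) ⟩
  0ℚ                                             ∎
  where
  halves : ∀ x → x ≡ ½ * (x + x)
  halves = solve-∀ ℚ-ring
  cancel : ∀ x → ½ * (x + - x) ≡ 0ℚ
  cancel = solve-∀ ℚ-ring

-- The first sheared row is swapped to the top, where linearity splits it; the part proportional to
-- v has a repeated row. The other sheared rows lie below v in the minors and are handled by
-- induction.
det-shear : ∀ {n} (v : Fin (suc n) → ℚ) (k : Fin n → ℚ) (R : Fin n → Fin (suc n) → ℚ) →
  det (v ▹ (λ i j → R i j + k i * v j)) ≡ det (v ▹ R)
det-shear {zero} v k R = refl
det-shear {suc n} v k R = begin
  det (v ▹ (λ i j → R i j + k i * v j))                                ≡⟨ det-cong (▹-congʳ v rows) ⟩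
  det (v ▹ (λ j → R zero j + k zero * v j) ▹ S′)                       ≡⟨ det-swap v (λ j → R zero j + k zero * v j) S′ ⟩
  - det ((λ j → R zero j + k zero * v j) ▹ v ▹ S′)                     ≡⟨ cong -_ (det-▹-linear (k zero) (R zero) v (v ▹ S′)) ⟩
  - (det (R zero ▹ v ▹ S′) + k zero * det (v ▹ v ▹ S′))                ≡⟨ cong (λ d → - (det (R zero ▹ v ▹ S′) + k zero * d)) (det-repeated v S′) ⟩
  - (det (R zero ▹ v ▹ S′) + k zero * 0ℚ)                              ≡⟨ drop (det (R zero ▹ v ▹ S′)) (k zero) ⟩
  - det (R zero ▹ v ▹ S′)                                              ≡⟨ cong -_ (det-▹-cong (R zero) (v ▹ S′) (v ▹ R ∘ suc) minors) ⟩
  - det (R zero ▹ v ▹ R ∘ suc)                                         ≡⟨ det-swap v (R zero) (R ∘ suc) ⟨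
  det (v ▹ R zero ▹ R ∘ suc)                                           ≡⟨ det-cong (▹-congʳ v (head-▹-tail R)) ⟨
  det (v ▹ R)                                                          ∎
  where
  S′ : Fin n → Fin (suc (suc n)) → ℚ
  S′ i j = R (suc i) j + k (suc i) * v j
  rows : ∀ i j → R i j + k i * v j ≡ ((λ j → R zero j + k zero * v j) ▹ S′) i j
  rows zero j = refl
  rows (suc i) j = refl
  drop : ∀ x k → - (x + k * 0ℚ) ≡ - x
  drop = solve-∀ ℚ-ring
  minors : ∀ c → det (minorOf (v ▹ S′) c) ≡ det (minorOf (v ▹ R ∘ suc) c)
  minors c = begin
    det (minorOf (v ▹ S′) c)                      ≡⟨ det-cong (minorOf-▹ v S′ c) ⟩
    det (v ∘ punchIn c ▹ minorOf S′ c)            ≡⟨ det-shear (v ∘ punchIn c) (k ∘ suc) (minorOf (R ∘ suc) c) ⟩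
    det (v ∘ punchIn c ▹ minorOf (R ∘ suc) c)     ≡⟨ det-cong (minorOf-▹ v (R ∘ suc) c) ⟨
    det (minorOf (v ▹ R ∘ suc) c)                 ∎

-- If the copied row is not directly below its copy, a swap moves `R zero` to the top, and every
-- minor still contains the repetition.
det-repeated-row : ∀ {n} (R : Fin n → Fin (suc n) → ℚ) p → det (R p ▹ R) ≡ 0ℚ
det-repeated-row {suc n} R zero = trans (det-cong (▹-congʳ (R zero) (head-▹-tail R))) (det-repeated (R zero) (R ∘ suc))
det-repeated-row {suc n} R (suc p) = begin
  det (R (suc p) ▹ R)                          ≡⟨ det-cong (▹-congʳ (R (suc p)) (head-▹-tail R)) ⟩
  det (R (suc p) ▹ R zero ▹ R ∘ suc)           ≡⟨ det-swap (R (suc p)) (R zero) (R ∘ suc) ⟩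
  - det (R zero ▹ R (suc p) ▹ R ∘ suc)         ≡⟨ cong -_ (det-▹-scale 0ℚ (R zero) (R (suc p) ▹ R ∘ suc) R minors) ⟩
  - (0ℚ * det (R zero ▹ R))                    ≡⟨ drop (det (R zero ▹ R)) ⟩
  0ℚ                                           ∎
  where
  drop : ∀ x → - (0ℚ * x) ≡ 0ℚ
  drop = solve-∀ ℚ-ring
  minors : ∀ c → det (minorOf (R (suc p) ▹ R ∘ suc) c) ≡ 0ℚ * det (minorOf R c)
  minors c = begin
    det (minorOf (R (suc p) ▹ R ∘ suc) c)                      ≡⟨ det-cong (minorOf-▹ (R (suc p)) (R ∘ suc) c) ⟩
    det (R (suc p) ∘ punchIn c ▹ minorOf (R ∘ suc) c)          ≡⟨ det-repeated-row (minorOf (R ∘ suc) c) p ⟩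
    0ℚ                                                         ≡⟨ *-zeroˡ (det (minorOf R c)) ⟨
    0ℚ * det (minorOf R c)                                     ∎

snoc : ∀ {m n} → (Fin m → Fin n → ℚ) → (Fin n → ℚ) → Fin (suc m) → Fin n → ℚ
snoc {zero} R v _ = v
snoc {suc m} R v zero = R zero
snoc {suc m} R v (suc i) = snoc (R ∘ suc) v i

minorOf-snoc : ∀ {m n} (R : Fin m → Fin (suc n) → ℚ) (v : Fin (suc n) → ℚ) c i j →
  minorOf (snoc R v) c i j ≡ snoc (minorOf R c) (v ∘ punchIn c) i j
minorOf-snoc {zero} R v c i j = refl
minorOf-snoc {suc m} R v c zero j = refl
minorOf-snoc {suc m} R v c (suc i) j = minorOf-snoc (R ∘ suc) v c i j

-- The row passes n others, one swap each. In `det-others` the row of the highest monomial arises on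
-- top and has to go to the bottom.
det-rotate : ∀ {n} (v : Fin (suc n) → ℚ) (R : Fin n → Fin (suc n) → ℚ) →
  det (v ▹ R) ≡ ((- 1ℚ) ^ n) * det (snoc R v)
det-rotate {zero} v R = sym (*-identityˡ (det (snoc R v)))
det-rotate {suc n} v R = begin
  det (v ▹ R)                                             ≡⟨ det-cong (▹-congʳ v (head-▹-tail R)) ⟩
  det (v ▹ R zero ▹ R ∘ suc)                              ≡⟨ det-swap v (R zero) (R ∘ suc) ⟩
  - det (R zero ▹ v ▹ R ∘ suc)                            ≡⟨ cong -_ (det-▹-scale ((- 1ℚ) ^ n) (R zero) (v ▹ R ∘ suc) (snoc (R ∘ suc) v) minors) ⟩
  - (((- 1ℚ) ^ n) * det (R zero ▹ snoc (R ∘ suc) v))      ≡⟨ neg ((- 1ℚ) ^ n) (det (R zero ▹ snoc (R ∘ suc) v)) ⟩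
  ((- 1ℚ) ^ suc n) * det (R zero ▹ snoc (R ∘ suc) v)      ≡⟨ cong (((- 1ℚ) ^ suc n) *_) (det-cong rows′) ⟩
  ((- 1ℚ) ^ suc n) * det (snoc R v)                       ∎
  where
  rows′ : ∀ i j → (R zero ▹ snoc (R ∘ suc) v) i j ≡ snoc R v i j
  rows′ zero j = refl
  rows′ (suc i) j = refl
  neg : ∀ s d → - (s * d) ≡ - 1ℚ * s * d
  neg = solve-∀ ℚ-ring
  minors : ∀ c → det (minorOf (v ▹ R ∘ suc) c) ≡ ((- 1ℚ) ^ n) * det (minorOf (snoc (R ∘ suc) v) c)
  minors c = begin
    det (minorOf (v ▹ R ∘ suc) c)                                        ≡⟨ det-cong (minorOf-▹ v (R ∘ suc) c) ⟩
    det (v ∘ punchIn c ▹ minorOf (R ∘ suc) c)                            ≡⟨ det-rotate (v ∘ punchIn c) (minorOf (R ∘ suc) c) ⟩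
    ((- 1ℚ) ^ n) * det (snoc (minorOf (R ∘ suc) c) (v ∘ punchIn c))      ≡⟨ cong (((- 1ℚ) ^ n) *_) (det-cong (minorOf-snoc (R ∘ suc) v c)) ⟨
    ((- 1ℚ) ^ n) * det (minorOf (snoc (R ∘ suc) v) c)                    ∎

det-scale-rows : ∀ {n} (k : Fin n → ℚ) (M : Fin n → Fin n → ℚ) → det (λ i j → k i * M i j) ≡ ΠF k * det M
det-scale-rows {zero} k M = refl
det-scale-rows {suc n} k M = begin
  ΣF (λ c → sgn c * (k zero * M zero c) * det (λ i j → k (suc i) * M (suc i) (punchIn c j)))
    ≡⟨ ΣF-cong (λ c → trans (cong (sgn c * (k zero * M zero c) *_) (det-scale-rows (k ∘ suc) (minorOf (M ∘ suc) c)))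
                  (pull (sgn c) (k zero) (M zero c) (ΠF (k ∘ suc)) (det (minorOf (M ∘ suc) c)))) ⟩
  ΣF (λ c → ΠF k * (sgn c * M zero c * det (minorOf (M ∘ suc) c)))
    ≡⟨ *-distribˡ-ΣF (ΠF k) (λ c → sgn c * M zero c * det (minorOf (M ∘ suc) c)) ⟨
  ΠF k * det M ∎
  where
  pull : ∀ s k m p d → s * (k * m) * (p * d) ≡ k * p * (s * m * d)
  pull = solve-∀ ℚ-ring

-- Expansion of a determinant over subsets of its rows

weight : ∀ {n} → (Fin n → ℚ) → Subset n → ℚ
weight u I = ΠF (λ i → if lookup I i then u i else 1ℚ)

-- Multilinearity in all rows at once, I being the set of rows that contribute the second summand.
-- `kernel-identity` uses it in both directions, once for each basis.
det-add-rows : ∀ {n} (a b : Fin n → Fin n → ℚ) (u : Fin n → ℚ) →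
  det (λ i j → a i j + u i * b i j) ≡
  sumOver (allSubsets n) (λ I → weight u I * det (λ i j → if lookup I i then b i j else a i j))
det-add-rows {zero} a b u = refl
det-add-rows {suc n} a b u = begin
  ΣF (λ c → sgn c * (a zero c + u zero * b zero c) * det (λ i j → a (suc i) (punchIn c j) + u (suc i) * b (suc i) (punchIn c j)))
    ≡⟨ ΣF-cong (λ c → trans (cong (sgn c * (a zero c + u zero * b zero c) *_)
                               (det-add-rows (minorOf (a ∘ suc) c) (minorOf (b ∘ suc) c) (u ∘ suc)))
                            (*-distribˡ-sumOver (sgn c * (a zero c + u zero * b zero c)) subsets (λ I → weight (u ∘ suc) I * d I c))) ⟩
  ΣF (λ c → sumOver subsets (λ I → sgn c * (a zero c + u zero * b zero c) * (weight (u ∘ suc) I * d I c)))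
    ≡⟨ ΣF-sumOver-swap subsets (λ c I → sgn c * (a zero c + u zero * b zero c) * (weight (u ∘ suc) I * d I c)) ⟩
  sumOver subsets (λ I → ΣF (λ c → sgn c * (a zero c + u zero * b zero c) * (weight (u ∘ suc) I * d I c)))
    ≡⟨ sumOver-cong subsets (λ I → firstRow I) ⟩
  sumOver subsets (λ I → term (inside ∷ I) + term (outside ∷ I))
    ≡⟨ sumOver-+ subsets (λ I → term (inside ∷ I)) (λ I → term (outside ∷ I)) ⟩
  sumOver subsets (λ I → term (inside ∷ I)) + sumOver subsets (λ I → term (outside ∷ I))
    ≡⟨ sumOver-subsets n term ⟨
  sumOver (allSubsets (suc n)) term ∎
  where
  subsets : List (Subset n)
  subsets = allSubsets n
  term : Subset (suc n) → ℚ
  term I = weight u I * det (λ i j → if lookup I i then b i j else a i j)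
  d : Subset n → Fin (suc n) → ℚ
  d I c = det (λ i j → if lookup I i then b (suc i) (punchIn c j) else a (suc i) (punchIn c j))
  split : ∀ s x u y w d → s * (x + u * y) * (w * d) ≡ u * w * (s * y * d) + 1ℚ * w * (s * x * d)
  split = solve-∀ ℚ-ring
  firstRow : ∀ I → ΣF (λ c → sgn c * (a zero c + u zero * b zero c) * (weight (u ∘ suc) I * d I c)) ≡
    term (inside ∷ I) + term (outside ∷ I)
  firstRow I = begin
    ΣF (λ c → sgn c * (a zero c + u zero * b zero c) * (weight (u ∘ suc) I * d I c))
      ≡⟨ ΣF-cong (λ c → split (sgn c) (a zero c) (u zero) (b zero c) w (d I c)) ⟩
    ΣF (λ c → u zero * w * (sgn c * b zero c * d I c) + 1ℚ * w * (sgn c * a zero c * d I c))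
      ≡⟨ ΣF-+ (λ c → u zero * w * (sgn c * b zero c * d I c)) (λ c → 1ℚ * w * (sgn c * a zero c * d I c)) ⟩
    ΣF (λ c → u zero * w * (sgn c * b zero c * d I c)) + ΣF (λ c → 1ℚ * w * (sgn c * a zero c * d I c))
      ≡⟨ cong₂ _+_ (*-distribˡ-ΣF (u zero * w) (λ c → sgn c * b zero c * d I c))
                   (*-distribˡ-ΣF (1ℚ * w) (λ c → sgn c * a zero c * d I c)) ⟨
    term (inside ∷ I) + term (outside ∷ I) ∎
    where
    w : ℚ
    w = weight (u ∘ suc) I

weight-const : ∀ {n} u (I : Subset n) → weight (λ _ → u) I ≡ u ^ ∣ I ∣
weight-const u [] = refl
weight-const u (inside ∷ I) = cong (u *_) (weight-const u I)
weight-const u (outside ∷ I) = trans (*-identityˡ (weight (λ _ → u) I)) (weight-const u I)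

-- Linear functionals on polynomials

-- A sequence G stands for the linear functional w^c ↦ G c on polynomials in w;
-- opL as G c is its value at w^c ∏_{a ∈ as} (w - a).
opL : List ℚ → (ℕ → ℚ) → ℕ → ℚ
opL [] G c = G c
opL (a ∷ as) G c = opL as G (suc c) - a * opL as G c

opL-cong : ∀ as {G H : ℕ → ℚ} → (∀ c → G c ≡ H c) → ∀ c → opL as G c ≡ opL as H c
opL-cong [] e c = e c
opL-cong (a ∷ as) e c = cong₂ (λ x y → x - a * y) (opL-cong as e (suc c)) (opL-cong as e c)

opL-++ : ∀ as bs G c → opL (as ++ bs) G c ≡ opL as (opL bs G) c
opL-++ [] bs G c = refl
opL-++ (a ∷ as) bs G c = cong₂ (λ x y → x - a * y) (opL-++ as bs G (suc c)) (opL-++ as bs G c)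

-- Linear factors commute; only the swap of two adjacent ones needs a computation.
opL-↭ : ∀ {as bs} → as ↭ bs → ∀ G c → opL as G c ≡ opL bs G c
opL-↭ ↭.refl G c = refl
opL-↭ (↭.prep a p) G c = cong₂ (λ x y → x - a * y) (opL-↭ p G (suc c)) (opL-↭ p G c)
opL-↭ (↭.swap {as} {bs} a b p) G c = begin
  X (2 ℕ.+ c) - b * X (suc c) - a * (X (suc c) - b * X c)      ≡⟨ commute a b (X (2 ℕ.+ c)) (X (suc c)) (X c) ⟩
  X (2 ℕ.+ c) - a * X (suc c) - b * (X (suc c) - a * X c)
    ≡⟨ cong₂ (λ x y → x - b * y) (cong₂ (λ x y → x - a * y) (opL-↭ p G (2 ℕ.+ c)) (opL-↭ p G (suc c)))
                                (cong₂ (λ x y → x - a * y) (opL-↭ p G (suc c)) (opL-↭ p G c)) ⟩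
  Y (2 ℕ.+ c) - a * Y (suc c) - b * (Y (suc c) - a * Y c)      ∎
  where
  X Y : ℕ → ℚ
  X = opL as G
  Y = opL bs G
  commute : ∀ a b x y z → x - b * y - a * (y - b * z) ≡ x - a * y - b * (y - a * z)
  commute = solve-∀ ℚ-ring
opL-↭ (↭.trans p q) G c = trans (opL-↭ p G c) (opL-↭ q G c)

opL-linear : ∀ as (A B : ℕ → ℚ) u c → opL as (λ c → A c + u * B c) c ≡ opL as A c + u * opL as B c
opL-linear [] A B u c = refl
opL-linear (a ∷ as) A B u c = begin
  opL as (λ c → A c + u * B c) (suc c) - a * opL as (λ c → A c + u * B c) c
    ≡⟨ cong₂ (λ x y → x - a * y) (opL-linear as A B u (suc c)) (opL-linear as A B u c) ⟩
  opL as A (suc c) + u * opL as B (suc c) - a * (opL as A c + u * opL as B c)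
    ≡⟨ regroup a u (opL as A (suc c)) (opL as B (suc c)) (opL as A c) (opL as B c) ⟩
  opL as A (suc c) - a * opL as A c + u * (opL as B (suc c) - a * opL as B c) ∎
  where
  regroup : ∀ a u w x y z → w + u * x - a * (y + u * z) ≡ w - a * y + u * (x - a * z)
  regroup = solve-∀ ℚ-ring

-- The substitution w ↦ w / t, homogenised to degree m, turns ∏ (w - a) into ∏ (w - t a).
opL-twist : ∀ t m as (B : ℕ → ℚ) c → c ℕ.+ length as ℕ.≤ m →
  opL as (λ d → (t ^ (m ℕ.∸ d)) * B d) c ≡ (t ^ (m ℕ.∸ (c ℕ.+ length as))) * opL (map (t *_) as) B c
opL-twist t m [] B c _ = cong (λ e → (t ^ (m ℕ.∸ e)) * B c) (sym (ℕ.+-identityʳ c))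
opL-twist t m (a ∷ as) B c le = begin
  opL as B′ (suc c) - a * opL as B′ c
    ≡⟨ cong₂ (λ x y → x - a * y) (opL-twist t m as B (suc c) le′) (opL-twist t m as B c (ℕ.≤-trans (ℕ.n≤1+n _) le′)) ⟩
  (t ^ (m ℕ.∸ (suc c ℕ.+ length as))) * X (suc c) - a * ((t ^ (m ℕ.∸ (c ℕ.+ length as))) * X c)
    -- By the bound, `∸` is exact here, so lowering the degree by one releases exactly one factor t.
    ≡⟨ cong (λ e → (t ^ (m ℕ.∸ (suc c ℕ.+ length as))) * X (suc c) - a * ((t ^ e) * X c)) (ℕ.+-∸-assoc 1 {m} {suc c ℕ.+ length as} le′) ⟩
  (t ^ (m ℕ.∸ (suc c ℕ.+ length as))) * X (suc c) - a * ((t ^ suc (m ℕ.∸ (suc c ℕ.+ length as))) * X c)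
    ≡⟨ factor (t ^ (m ℕ.∸ (suc c ℕ.+ length as))) a t (X (suc c)) (X c) ⟩
  (t ^ (m ℕ.∸ (suc c ℕ.+ length as))) * (X (suc c) - t * a * X c)
    ≡⟨ cong (λ e → (t ^ (m ℕ.∸ e)) * (X (suc c) - t * a * X c)) (sym (ℕ.+-suc c (length as))) ⟩
  (t ^ (m ℕ.∸ (c ℕ.+ suc (length as)))) * (X (suc c) - t * a * X c) ∎
  where
  B′ X : ℕ → ℚ
  B′ d = (t ^ (m ℕ.∸ d)) * B d
  X = opL (map (t *_) as) B
  le′ : suc c ℕ.+ length as ℕ.≤ m
  le′ = subst (ℕ._≤ m) (ℕ.+-suc c (length as)) le
  factor : ∀ e a t x y → e * x - a * (t * e * y) ≡ e * (x - t * a * y)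
  factor = solve-∀ ℚ-ring

-- Rows belong to monomials and columns to functionals, transposed against the matrices of the
-- theorem, so that a change of polynomial basis consists of row operations.
monomialRows : ∀ {m n} → (Fin n → ℕ → ℚ) → Fin m → Fin n → ℚ
monomialRows G p r = G r (toℕ p)

det-monomial-repeated : ∀ {m} (G : Fin (suc m) → ℕ → ℚ) c → c ℕ.< m → det ((λ r → G r c) ▹ monomialRows {m} G) ≡ 0ℚ
det-monomial-repeated G c c<m = begin
  det ((λ r → G r c) ▹ monomialRows G)                        ≡⟨ det-cong (▹-congˡ (monomialRows G) (λ r → cong (G r) (sym (toℕ-fromℕ< c<m)))) ⟩
  det (monomialRows G (fromℕ< c<m) ▹ monomialRows G)          ≡⟨ det-repeated-row (monomialRows G) (fromℕ< c<m) ⟩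
  0ℚ                                                          ∎

-- In the expansion of w^c ∏ (w - a) every monomial below the leading one has degree less than m and
-- so repeats one of the rows underneath.
det-leading : ∀ {m} as (G : Fin (suc m) → ℕ → ℚ) c → c ℕ.+ length as ℕ.≤ m →
  det ((λ r → opL as (G r) c) ▹ monomialRows {m} G) ≡ det ((λ r → G r (c ℕ.+ length as)) ▹ monomialRows {m} G)
det-leading [] G c _ = det-cong (▹-congˡ (monomialRows G) (λ r → cong (G r) (sym (ℕ.+-identityʳ c))))
det-leading {m} (a ∷ as) G c le = begin
  det ((λ r → opL as (G r) (suc c) - a * opL as (G r) c) ▹ P)
    ≡⟨ det-cong (▹-congˡ P (λ r → minus (opL as (G r) (suc c)) a (opL as (G r) c))) ⟩
  det ((λ r → opL as (G r) (suc c) + (- a) * opL as (G r) c) ▹ P)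
    ≡⟨ det-▹-linear (- a) (λ r → opL as (G r) (suc c)) (λ r → opL as (G r) c) P ⟩
  det ((λ r → opL as (G r) (suc c)) ▹ P) + (- a) * det ((λ r → opL as (G r) c) ▹ P)
    ≡⟨ cong₂ (λ x y → x + (- a) * y) (det-leading as G (suc c) le′) (det-leading as G c (ℕ.≤-trans (ℕ.n≤1+n _) le′)) ⟩
  det ((λ r → G r (suc c ℕ.+ length as)) ▹ P) + (- a) * det ((λ r → G r (c ℕ.+ length as)) ▹ P)
    ≡⟨ cong (λ y → det ((λ r → G r (suc c ℕ.+ length as)) ▹ P) + (- a) * y) (det-monomial-repeated G (c ℕ.+ length as) le′) ⟩
  det ((λ r → G r (suc c ℕ.+ length as)) ▹ P) + (- a) * 0ℚ
    ≡⟨ drop (det ((λ r → G r (suc c ℕ.+ length as)) ▹ P)) a ⟩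
  det ((λ r → G r (suc c ℕ.+ length as)) ▹ P)
    ≡⟨ det-cong (▹-congˡ P (λ r → cong (G r) (sym (ℕ.+-suc c (length as))))) ⟩
  det ((λ r → G r (c ℕ.+ suc (length as))) ▹ P) ∎
  where
  P : Fin m → Fin (suc m) → ℚ
  P = monomialRows G
  le′ : suc c ℕ.+ length as ℕ.≤ m
  le′ = subst (ℕ._≤ m) (ℕ.+-suc c (length as)) le
  minus : ∀ x a y → x - a * y ≡ x + (- a) * y
  minus = solve-∀ ℚ-ring
  drop : ∀ x a → x + (- a) * 0ℚ ≡ x
  drop = solve-∀ ℚ-ring

snoc-monomial : ∀ {n} m (f : ℕ → Fin n → ℚ) i j → snoc (λ (p : Fin m) → f (toℕ p)) (f m) i j ≡ f (toℕ i) j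
snoc-monomial zero f zero j = refl
snoc-monomial (suc m) f zero j = refl
snoc-monomial (suc m) f (suc i) j = snoc-monomial m (f ∘ suc) i j

-- The differences are taken in the order for which `det-others` has no sign.
vandermonde : ∀ {n} → (Fin n → ℚ) → ℚ
vandermonde {zero} y = 1ℚ
vandermonde {suc n} y = ΠF (λ j → y zero - y (suc j)) * vandermonde (y ∘ suc)

others : ∀ {A : Set} {n} → (Fin (suc n) → A) → Fin (suc n) → List A
others y j = tabulate (y ∘ punchIn j)

tabulate-others : ∀ {A : Set} {n} (y : Fin (suc n) → A) j → tabulate y ↭ y j ∷ others y j
tabulate-others y zero = ↭.refl
tabulate-others {n = suc n} y (suc j) = ↭.trans (↭.prep (y zero) (tabulate-others (y ∘ suc) j)) (↭.swap (y zero) (y (suc j)) ↭.refl)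

-- In `det-others` the row operations produce y_j - y_0 where `vandermonde` has y_0 - y_j; the sign
-- of `det-rotate` makes up for it.
ΠF-neg : ∀ {n} (f g : Fin n → ℚ) → ΠF (λ j → f j - g j) * ((- 1ℚ) ^ n) ≡ ΠF (λ j → g j - f j)
ΠF-neg {zero} f g = refl
ΠF-neg {suc n} f g = begin
  (f zero - g zero) * ΠF (λ j → f (suc j) - g (suc j)) * (- 1ℚ * ((- 1ℚ) ^ n))
    ≡⟨ regroup (f zero) (g zero) (ΠF (λ j → f (suc j) - g (suc j))) ((- 1ℚ) ^ n) ⟩
  (g zero - f zero) * (ΠF (λ j → f (suc j) - g (suc j)) * ((- 1ℚ) ^ n))
    ≡⟨ cong ((g zero - f zero) *_) (ΠF-neg (f ∘ suc) (g ∘ suc)) ⟩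
  (g zero - f zero) * ΠF (λ j → g (suc j) - f (suc j)) ∎
  where
  regroup : ∀ f g p s → (f - g) * p * (- 1ℚ * s) ≡ (g - f) * (p * s)
  regroup = solve-∀ ℚ-ring

-- The change of basis from monomials to the products ∏_{i ≠ j} (w - y_i). Since
-- ∏_{i ≠ j} (w - y_i) - ∏_{i ≠ 0} (w - y_i) = (y_j - y_0) ∏_{i ≠ 0, j} (w - y_i),
-- subtracting row 0 from the others reduces the number of nodes by one.
det-others : ∀ {m} (y : Fin (suc m) → ℚ) (G : Fin (suc m) → ℕ → ℚ) →
  det (λ j r → opL (others y j) (G r) 0) ≡ vandermonde y * det (monomialRows {suc m} G)
det-others {zero} y G = sym (*-identityˡ (det (monomialRows {1} G)))
det-others {suc m} y G = begin
  det (λ j r → opL (others y j) (G r) 0)                    ≡⟨ det-cong rows ⟩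
  det (v ▹ (λ j r → k j * N j r + 1ℚ * v r))                ≡⟨ det-shear v (λ _ → 1ℚ) (λ j r → k j * N j r) ⟩
  -- Deleting column c leaves the products for the nodes y′ under the functionals other than `G c`,
  -- to which the induction hypothesis applies.
  det (v ▹ (λ j r → k j * N j r))                           ≡⟨ det-▹-scale (ΠF k * vandermonde y′) v (λ j r → k j * N j r) P minors ⟩
  -- Above the monomials of degree at most m, only the leading monomial w^(m+1) of v counts.
  ΠF k * vandermonde y′ * det (v ▹ P)                       ≡⟨ cong (ΠF k * vandermonde y′ *_) leading ⟩
  ΠF k * vandermonde y′ * (((- 1ℚ) ^ suc m) * det (monomialRows {suc (suc m)} G))
    ≡⟨ regroup (ΠF k) (vandermonde y′) ((- 1ℚ) ^ suc m) (det (monomialRows {suc (suc m)} G)) ⟩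
  ΠF k * ((- 1ℚ) ^ suc m) * vandermonde y′ * det (monomialRows {suc (suc m)} G)
    ≡⟨ cong (λ p → p * vandermonde y′ * det (monomialRows {suc (suc m)} G)) (ΠF-neg y′ (λ _ → y zero)) ⟩
  vandermonde y * det (monomialRows {suc (suc m)} G)        ∎
  where
  y′ k : Fin (suc m) → ℚ
  y′ = y ∘ suc
  k j = y′ j - y zero
  v : Fin (suc (suc m)) → ℚ
  v r = opL (tabulate y′) (G r) 0
  N P : Fin (suc m) → Fin (suc (suc m)) → ℚ
  N j r = opL (others y′ j) (G r) 0
  P = monomialRows G
  difference : ∀ x₁ x₀ a b → x₁ - a * x₀ ≡ (b - a) * x₀ + 1ℚ * (x₁ - b * x₀)
  difference = solve-∀ ℚ-ring
  rows : ∀ j r → opL (others y j) (G r) 0 ≡ (v ▹ (λ j r → k j * N j r + 1ℚ * v r)) j r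
  rows zero r = refl
  rows (suc j) r = begin
    opL (others y′ j) (G r) 1 - y zero * N j r
      ≡⟨ difference (opL (others y′ j) (G r) 1) (N j r) (y zero) (y′ j) ⟩
    k j * N j r + 1ℚ * opL (y′ j ∷ others y′ j) (G r) 0
      ≡⟨ cong (λ x → k j * N j r + 1ℚ * x) (opL-↭ (tabulate-others y′ j) (G r) 0) ⟨
    k j * N j r + 1ℚ * v r ∎
  minors : ∀ c → det (minorOf (λ j r → k j * N j r) c) ≡ ΠF k * vandermonde y′ * det (minorOf P c)
  minors c = begin
    det (minorOf (λ j r → k j * N j r) c)             ≡⟨ det-scale-rows k (minorOf N c) ⟩
    ΠF k * det (minorOf N c)                          ≡⟨ cong (ΠF k *_) (det-others y′ (G ∘ punchIn c)) ⟩
    ΠF k * (vandermonde y′ * det (minorOf P c))       ≡⟨ assoc (ΠF k) (vandermonde y′) (det (minorOf P c)) ⟩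
    ΠF k * vandermonde y′ * det (minorOf P c)         ∎
    where
    assoc : ∀ a b c → a * (b * c) ≡ a * b * c
    assoc = solve-∀ ℚ-ring
  leading : det (v ▹ P) ≡ ((- 1ℚ) ^ suc m) * det (monomialRows {suc (suc m)} G)
  leading = begin
    det (v ▹ P)
      ≡⟨ det-leading (tabulate y′) G 0 (ℕ.≤-reflexive (length-tabulate y′)) ⟩
    det ((λ r → G r (length (tabulate y′))) ▹ P)
      ≡⟨ cong (λ l → det ((λ r → G r l) ▹ P)) (length-tabulate y′) ⟩
    det ((λ r → G r (suc m)) ▹ P)
      ≡⟨ det-rotate (λ r → G r (suc m)) P ⟩
    ((- 1ℚ) ^ suc m) * det (snoc P (λ r → G r (suc m)))
      ≡⟨ cong (((- 1ℚ) ^ suc m) *_) (det-cong (snoc-monomial (suc m) (λ c r → G r c))) ⟩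
    ((- 1ℚ) ^ suc m) * det (monomialRows {suc (suc m)} G) ∎
  regroup : ∀ a b c d → a * b * (c * d) ≡ a * c * b * d
  regroup = solve-∀ ℚ-ring

-- Complete homogeneous symmetric functions

-- The function upTo local to hsRev cannot be named outside of Defs. In each mutual block below,
-- the unknown sides of the first equation are solved by the second lemma, in whose goal the wanted
-- function has been brought to distinct variables by with-abstraction; lhs then recovers it.
lhs : ∀ {A : Set} {a b : A} → a ≡ b → A
lhs {a = a} _ = a

mutual
  num : (E : Alph) (j : ℕ) → _≡_ {A = ℚ} _ _
  num-solved : (E : Alph) (j : ℕ) → hsRev E (suc j) ≡ (lhs (num E j) ⊘ fromℕ (suc j)) ∷ hsRev E j
  num-solved E j = refl
  num E j = refl

mutual
  numOf : (E : Alph) (j : ℕ) (h : List ℚ) → _≡_ {A = ℚ} _ _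
  numOf-solved : (E : Alph) (j : ℕ) → lhs (num E j) ≡ lhs (num E j)
  numOf-solved E j with hsRev E j
  ... | h = numOf E j h
  numOf E j h = refl

mutual
  upToHandle : (E : Alph) (w m : ℕ) → _≡_ {A = List ℕ} _ _
  upToHandle-solved : (E : Alph) (m : ℕ) (h : List ℚ) → lhs (numOf E (suc m) h) ≡ lhs (numOf E (suc m) h)
  upToHandle-solved E m h with suc m | map {A = ℕ} {B = ℚ} | _++_ {A = ℕ}
  ... | w | mp | app = cong (λ l → sumL (zipWith _*_ (mp (λ i → E (suc i)) (app (app l (m ∷ [])) (w ∷ []))) h)) (upToHandle E w m)
  upToHandle E w m = refl

-- The local `upTo` carries the arguments of its enclosing clause, here E and w; its values do not
-- depend on them.
upToHandle≡upTo : ∀ E w m → lhs (upToHandle E w m) ≡ upTo m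
upToHandle≡upTo E w zero = refl
upToHandle≡upTo E w (suc m) = trans (cong (_++ (m ∷ [])) (upToHandle≡upTo E w m)) (upTo-∷ʳ m)

-- The Cauchy product, summed in the order of `hsRev`, which lists S_j first and S_0 last.
conv : (ℕ → ℚ) → (ℕ → ℚ) → ℕ → ℚ
conv f g zero = f 0 * g 0
conv f g (suc j) = f 0 * g (suc j) + conv (f ∘ suc) g j

conv-congˡ : ∀ {f f′ : ℕ → ℚ} g → (∀ i → f i ≡ f′ i) → ∀ j → conv f g j ≡ conv f′ g j
conv-congˡ g e zero = cong (_* g 0) (e 0)
conv-congˡ g e (suc j) = cong₂ (λ x y → x * g (suc j) + y) (e 0) (conv-congˡ g (e ∘ suc) j)

conv-congʳ : ∀ f {g g′ : ℕ → ℚ} j → (∀ i → i ℕ.≤ j → g i ≡ g′ i) → conv f g j ≡ conv f g′ j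
conv-congʳ f zero e = cong (f 0 *_) (e 0 ℕ.z≤n)
conv-congʳ f (suc j) e = cong₂ (λ x y → f 0 * x + y) (e (suc j) ℕ.≤-refl) (conv-congʳ (f ∘ suc) j (λ i le → e i (ℕ.m≤n⇒m≤1+n le)))

zipWith-hsRev : ∀ E (f : ℕ → ℚ) j → sumL (zipWith _*_ (applyUpTo f (suc j)) (hsRev E j)) ≡ conv f (λ i → S i E) j
zipWith-hsRev E f zero = +-identityʳ (f 0 * 1ℚ)
zipWith-hsRev E f (suc j) = cong (f 0 * S (suc j) E +_) (zipWith-hsRev E (f ∘ suc) j)

newton : ∀ E j → S (suc j) E ≡ conv (E ∘ suc) (λ i → S i E) j ⊘ fromℕ (suc j)
newton E j = cong (_⊘ fromℕ (suc j)) (begin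
  sumL (zipWith _*_ (map (E ∘ suc) (lhs (upToHandle E j j) ++ (j ∷ []))) (hsRev E j))
    ≡⟨ cong (λ l → sumL (zipWith _*_ (map (E ∘ suc) (l ++ (j ∷ []))) (hsRev E j))) (upToHandle≡upTo E j j) ⟩
  sumL (zipWith _*_ (map (E ∘ suc) (upTo j ++ (j ∷ []))) (hsRev E j))
    ≡⟨ cong (λ l → sumL (zipWith _*_ (map (E ∘ suc) l) (hsRev E j))) (upTo-∷ʳ j) ⟩
  sumL (zipWith _*_ (map (E ∘ suc) (upTo (suc j))) (hsRev E j))
    ≡⟨ cong (λ l → sumL (zipWith _*_ l (hsRev E j))) (map-upTo (E ∘ suc) (suc j)) ⟩
  sumL (zipWith _*_ (applyUpTo (E ∘ suc) (suc j)) (hsRev E j))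
    ≡⟨ zipWith-hsRev E (E ∘ suc) j ⟩
  conv (E ∘ suc) (λ i → S i E) j ∎)

-- Division in ℚ and uniqueness in Newton's recursion

⊘-*-cancel : ∀ p {d} → d ≢ 0ℚ → (p ⊘ d) * d ≡ p
⊘-*-cancel p {d} d≢0 with d ≟ 0ℚ
... | yes d≡0 = contradiction d≡0 d≢0
... | no d≢0′ = begin
  p * (1/ d) * d      ≡⟨ assoc p (1/ d) d ⟩
  p * ((1/ d) * d)    ≡⟨ cong (p *_) (*-inverseˡ d) ⟩
  p * 1ℚ              ≡⟨ unit p ⟩
  p                   ∎
  where
  instance
    d-nonZero : NonZero d
    d-nonZero = ≢-nonZero d≢0′
  assoc : ∀ a b c → a * b * c ≡ a * (b * c)
  assoc = solve-∀ ℚ-ring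
  unit : ∀ a → a * 1ℚ ≡ a
  unit = solve-∀ ℚ-ring

*-cancelʳ-≢0 : ∀ {a b d} → d ≢ 0ℚ → a * d ≡ b * d → a ≡ b
*-cancelʳ-≢0 {a} {b} {d} d≢0 e = begin
  a                          ≡⟨ unit a ⟩
  a * 1ℚ                     ≡⟨ cong (a *_) (⊘-*-cancel 1ℚ d≢0) ⟨
  a * ((1ℚ ⊘ d) * d)         ≡⟨ shuffle a (1ℚ ⊘ d) d ⟩
  a * d * (1ℚ ⊘ d)           ≡⟨ cong (_* (1ℚ ⊘ d)) e ⟩
  b * d * (1ℚ ⊘ d)           ≡⟨ shuffle b (1ℚ ⊘ d) d ⟨
  b * ((1ℚ ⊘ d) * d)         ≡⟨ cong (b *_) (⊘-*-cancel 1ℚ d≢0) ⟩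
  b * 1ℚ                     ≡⟨ unit b ⟨
  b                          ∎
  where
  unit : ∀ a → a ≡ a * 1ℚ
  unit = solve-∀ ℚ-ring
  shuffle : ∀ a r d → a * (r * d) ≡ a * d * r
  shuffle = solve-∀ ℚ-ring

*-≢0 : ∀ {a b} → a ≢ 0ℚ → b ≢ 0ℚ → a * b ≢ 0ℚ
*-≢0 {a} {b} a≢0 b≢0 e = a≢0 (*-cancelʳ-≢0 b≢0 (trans e (sym (*-zeroˡ b))))

-- The fraction in `fromℕ` is normalised by a gcd, which does not compute for a variable j; the
-- detour through unnormalised rationals avoids it.
fromℕ-suc : ∀ j → fromℕ (suc j) ≡ 1ℚ + fromℕ j
fromℕ-suc j = toℚᵘ-injective (ℚᵘ.≃-trans (toℚᵘ-fromℚᵘ (mkℚᵘ (ℤ.+ suc j) 0))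
  (ℚᵘ.≃-sym (ℚᵘ.≃-trans (toℚᵘ-homo-+ 1ℚ (fromℕ j))
    (ℚᵘ.≃-trans (ℚᵘ.+-congʳ (toℚᵘ 1ℚ) (toℚᵘ-fromℚᵘ (mkℚᵘ (ℤ.+ j) 0))) (*≡* (cong (λ i → (ℤ.+ 1 ℤ.+ i) ℤ.* ℤ.+ 1) (ℤ.*-identityʳ (ℤ.+ j))))))))

positive⇒≢0 : ∀ p .{{_ : Positive p}} → p ≢ 0ℚ
positive⇒≢0 .0ℚ {{()}} refl

fromℕ-suc≢0 : ∀ j → fromℕ (suc j) ≢ 0ℚ
fromℕ-suc≢0 j = positive⇒≢0 (fromℕ (suc j)) {{normalize-pos (suc j) 1}}

newton-* : ∀ E j → S (suc j) E * fromℕ (suc j) ≡ conv (E ∘ suc) (λ i → S i E) j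
newton-* E j = trans (cong (_* fromℕ (suc j)) (newton E j)) (⊘-*-cancel _ (fromℕ-suc≢0 j))

-- The recursion determines each value from all earlier ones, because j + 1 is nonzero in ℚ. To
-- identify the S_j of an alphabet it thus suffices to exhibit a sequence that satisfies it.
newton-unique : ∀ E (b : ℕ → ℚ) → b 0 ≡ 1ℚ → (∀ j → b (suc j) * fromℕ (suc j) ≡ conv (E ∘ suc) b j) → ∀ j → S j E ≡ b j
newton-unique E b b0 rec j = upToIndex j j ℕ.≤-refl
  where
  upToIndex : ∀ j i → i ℕ.≤ j → S i E ≡ b i
  upToIndex zero zero _ = sym b0
  upToIndex (suc j) i le with ℕ.m≤n⇒m<n∨m≡n le
  ... | inj₁ (ℕ.s≤s i≤j) = upToIndex j i i≤j
  ... | inj₂ refl = *-cancelʳ-≢0 (fromℕ-suc≢0 j)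
          (trans (newton-* E j) (trans (conv-congʳ (E ∘ suc) j (upToIndex j)) (sym (rec j))))

S-cong : ∀ {A B : Alph} → (∀ i → A (suc i) ≡ B (suc i)) → ∀ j → S j A ≡ S j B
S-cong {A} {B} e j = sym (newton-unique B (λ i → S i A) refl
  (λ j → trans (newton-* A j) (conv-congˡ (λ i → S i A) e j)) j)

-- Removing a variable a from A multiplies H(z) = Σ S_j[A] z^j by 1 - a z. The b j are the
-- coefficients of the product; they are shown to satisfy Newton's recursion of the smaller
-- alphabet.
module RemoveVariable (A : Alph) (a : ℚ) where

  h b : ℕ → ℚ
  h j = S j A
  b zero = 1ℚ
  b (suc j) = h (suc j) - a * h j

  conv-b : ∀ f j → conv f b (suc j) ≡ conv f h (suc j) - a * conv f h j
  conv-b f zero = base (f 0) (f 1) (h 1) a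
    where
    base : ∀ x y h a → x * (h - a * 1ℚ) + y * 1ℚ ≡ x * h + y * 1ℚ - a * (x * 1ℚ)
    base = solve-∀ ℚ-ring
  conv-b f (suc j) = trans (cong (f 0 * b (suc (suc j)) +_) (conv-b (f ∘ suc) j))
    (step (f 0) (h (suc (suc j))) (h (suc j)) a (conv (f ∘ suc) h (suc j)) (conv (f ∘ suc) h j))
    where
    step : ∀ x h k a c d → x * (h - a * k) + (c - a * d) ≡ x * h + c - a * (x * k + d)
    step = solve-∀ ℚ-ring

  -- The factor 1 - a z in the series of b cancels the geometric series c / (1 - a z).
  conv-geometric : ∀ c j → conv (λ i → c * (a ^ i)) b j ≡ c * h j
  conv-geometric c zero = base c
    where
    base : ∀ c → c * 1ℚ * 1ℚ ≡ c * 1ℚ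
    base = solve-∀ ℚ-ring
  conv-geometric c (suc j) = begin
    c * 1ℚ * b (suc j) + conv (λ i → c * (a * (a ^ i))) b j
      ≡⟨ cong (c * 1ℚ * b (suc j) +_) (conv-congˡ b (λ i → assoc c a (a ^ i)) j) ⟩
    c * 1ℚ * b (suc j) + conv (λ i → c * a * (a ^ i)) b j
      ≡⟨ cong (c * 1ℚ * b (suc j) +_) (conv-geometric (c * a) j) ⟩
    c * 1ℚ * b (suc j) + c * a * h j
      ≡⟨ telescope c a (h (suc j)) (h j) ⟩
    c * h (suc j) ∎
    where
    assoc : ∀ a b c → a * (b * c) ≡ a * b * c
    assoc = solve-∀ ℚ-ring
    telescope : ∀ c a h k → c * 1ℚ * (h - a * k) + c * a * k ≡ c * h
    telescope = solve-∀ ℚ-ring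

  conv-- : ∀ (f g : ℕ → ℚ) u j → conv (λ i → f i - g i) u j ≡ conv f u j - conv g u j
  conv-- f g u zero = distrib (f 0) (g 0) (u 0)
    where
    distrib : ∀ x y z → (x - y) * z ≡ x * z - y * z
    distrib = solve-∀ ℚ-ring
  conv-- f g u (suc j) = trans (cong ((f 0 - g 0) * u (suc j) +_) (conv-- (f ∘ suc) (g ∘ suc) u j))
    (distrib (f 0) (g 0) (u (suc j)) (conv (f ∘ suc) u j) (conv (g ∘ suc) u j))
    where
    distrib : ∀ x y z c d → (x - y) * z + (c - d) ≡ x * z + c - (y * z + d)
    distrib = solve-∀ ℚ-ring

  -- Newton's identity says that the power sum series of A times H is H′. This is the coefficient of
  -- z^j in (1 - a z) H′ = ((1 - a z) H)′ + a H.
  convA-b : ∀ j → conv (A ∘ suc) b j ≡ b (suc j) * fromℕ (suc j) + a * h j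
  convA-b zero = begin
    conv (A ∘ suc) h 0                        ≡⟨ newton-* A 0 ⟨
    h 1 * 1ℚ                                  ≡⟨ base (h 1) a ⟩
    (h 1 - a * 1ℚ) * 1ℚ + a * 1ℚ              ∎
    where
    base : ∀ h a → h * 1ℚ ≡ (h - a * 1ℚ) * 1ℚ + a * 1ℚ
    base = solve-∀ ℚ-ring
  convA-b (suc j) = begin
    conv (A ∘ suc) b (suc j)
      ≡⟨ conv-b (A ∘ suc) j ⟩
    conv (A ∘ suc) h (suc j) - a * conv (A ∘ suc) h j
      ≡⟨ cong₂ (λ x y → x - a * y) (newton-* A (suc j)) (newton-* A j) ⟨
    h (suc (suc j)) * fromℕ (suc (suc j)) - a * (h (suc j) * fromℕ (suc j))
      ≡⟨ cong (λ f → h (suc (suc j)) * f - a * (h (suc j) * fromℕ (suc j))) (fromℕ-suc (suc j)) ⟩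
    h (suc (suc j)) * (1ℚ + fromℕ (suc j)) - a * (h (suc j) * fromℕ (suc j))
      ≡⟨ step (h (suc (suc j))) (h (suc j)) a (fromℕ (suc j)) ⟩
    (h (suc (suc j)) - a * h (suc j)) * (1ℚ + fromℕ (suc j)) + a * h (suc j)
      ≡⟨ cong (λ f → (h (suc (suc j)) - a * h (suc j)) * f + a * h (suc j)) (fromℕ-suc (suc j)) ⟨
    b (suc (suc j)) * fromℕ (suc (suc j)) + a * h (suc j) ∎
    where
    step : ∀ h k a f → h * (1ℚ + f) - a * (k * f) ≡ (h - a * k) * (1ℚ + f) + a * k
    step = solve-∀ ℚ-ring

  S-remove : ∀ (B : Alph) → (∀ i → A (suc i) ≡ B (suc i) + a ^ suc i) → ∀ j → S j B ≡ b j
  S-remove B e = newton-unique B b refl λ j → begin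
    b (suc j) * fromℕ (suc j)                                   ≡⟨ cancel (b (suc j) * fromℕ (suc j)) (a * h j) ⟩
    b (suc j) * fromℕ (suc j) + a * h j - a * h j               ≡⟨ cong₂ _-_ (convA-b j) (conv-geometric a j) ⟨
    conv (A ∘ suc) b j - conv (λ i → a ^ suc i) b j             ≡⟨ conv-- (A ∘ suc) (λ i → a ^ suc i) b j ⟨
    conv (λ i → A (suc i) - a ^ suc i) b j                      ≡⟨ conv-congˡ b (λ i → move (A (suc i)) (B (suc i)) (a ^ suc i) (e i)) j ⟩
    conv (B ∘ suc) b j                                          ∎
    where
    cancel : ∀ x y → x ≡ x + y - y
    cancel = solve-∀ ℚ-ring
    move : ∀ x y z → x ≡ y + z → x - z ≡ y
    move .(y + z) y z refl = sym (cancel y z)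

Sℤ-remove : ∀ {A B : Alph} a → (∀ i → A (suc i) ≡ B (suc i) + a ^ suc i) → ∀ m → Sℤ (ℤ.+ 1 ℤ.+ m) B ≡ Sℤ (ℤ.+ 1 ℤ.+ m) A - a * Sℤ m A
Sℤ-remove {A} {B} a e (ℤ.+ j) = RemoveVariable.S-remove A a B e (suc j)
Sℤ-remove {A} {B} a e -[1+ zero ] = unit a
  where
  unit : ∀ a → 1ℚ ≡ 1ℚ - a * 0ℚ
  unit = solve-∀ ℚ-ring
Sℤ-remove {A} {B} a e -[1+ suc k ] = zeros a
  where
  zeros : ∀ a → 0ℚ ≡ 0ℚ - a * 0ℚ
  zeros = solve-∀ ℚ-ring

-- Each factor w - z removes the variable z by `Sℤ-remove`. Its w raises the index by one, whence
-- the shift by `length zs`.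
opL-S : ∀ zs (A B : Alph) → (∀ i → A (suc i) ≡ B (suc i) + sumOver zs (_^ suc i)) →
  ∀ b c → opL zs (λ c → Sℤ (b ℤ.+ ℤ.+ c) A) c ≡ Sℤ (b ℤ.+ ℤ.+ (length zs ℕ.+ c)) B
opL-S [] A B e b c = Sℤ-cong (b ℤ.+ ℤ.+ c)
  where
  Sℤ-cong : ∀ m → Sℤ m A ≡ Sℤ m B
  Sℤ-cong (ℤ.+ j) = S-cong (λ i → trans (e i) (+-identityʳ (B (suc i)))) j
  Sℤ-cong -[1+ j ] = refl
opL-S (z ∷ zs) A B e b c = begin
  opL zs F (suc c) - z * opL zs F c
    ≡⟨ cong₂ (λ x y → x - z * y) (opL-S zs A B′ e′ b (suc c)) (opL-S zs A B′ e′ b c) ⟩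
  Sℤ (b ℤ.+ ℤ.+ (length zs ℕ.+ suc c)) B′ - z * Sℤ (b ℤ.+ ℤ.+ (length zs ℕ.+ c)) B′
    ≡⟨ cong (λ l → Sℤ (b ℤ.+ ℤ.+ l) B′ - z * Sℤ (b ℤ.+ ℤ.+ (length zs ℕ.+ c)) B′) (ℕ.+-suc (length zs) c) ⟩
  Sℤ (b ℤ.+ ℤ.+ suc (length zs ℕ.+ c)) B′ - z * Sℤ (b ℤ.+ ℤ.+ (length zs ℕ.+ c)) B′
    ≡⟨ cong (λ i → Sℤ i B′ - z * Sℤ (b ℤ.+ ℤ.+ (length zs ℕ.+ c)) B′) index ⟩
  Sℤ (ℤ.+ 1 ℤ.+ (b ℤ.+ ℤ.+ (length zs ℕ.+ c))) B′ - z * Sℤ (b ℤ.+ ℤ.+ (length zs ℕ.+ c)) B′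
    ≡⟨ Sℤ-remove {B′} {B} z (λ i → refl) (b ℤ.+ ℤ.+ (length zs ℕ.+ c)) ⟨
  Sℤ (ℤ.+ 1 ℤ.+ (b ℤ.+ ℤ.+ (length zs ℕ.+ c))) B
    ≡⟨ cong (λ i → Sℤ i B) index ⟨
  Sℤ (b ℤ.+ ℤ.+ suc (length zs ℕ.+ c)) B ∎
  where
  F : ℕ → ℚ
  F c = Sℤ (b ℤ.+ ℤ.+ c) A
  B′ : Alph
  B′ i = B i + z ^ i
  assoc : ∀ a b c → a + (b + c) ≡ a + b + c
  assoc = solve-∀ ℚ-ring
  e′ : ∀ i → A (suc i) ≡ B′ (suc i) + sumOver zs (_^ suc i)
  e′ i = trans (e i) (assoc (B (suc i)) (z ^ suc i) (sumOver zs (_^ suc i)))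
  index : b ℤ.+ ℤ.+ suc (length zs ℕ.+ c) ≡ ℤ.+ 1 ℤ.+ (b ℤ.+ ℤ.+ (length zs ℕ.+ c))
  index = begin
    b ℤ.+ (ℤ.+ 1 ℤ.+ ℤ.+ (length zs ℕ.+ c))      ≡⟨ ℤ.+-assoc b (ℤ.+ 1) (ℤ.+ (length zs ℕ.+ c)) ⟨
    b ℤ.+ ℤ.+ 1 ℤ.+ ℤ.+ (length zs ℕ.+ c)        ≡⟨ cong (ℤ._+ ℤ.+ (length zs ℕ.+ c)) (ℤ.+-comm b (ℤ.+ 1)) ⟩
    ℤ.+ 1 ℤ.+ b ℤ.+ ℤ.+ (length zs ℕ.+ c)        ≡⟨ ℤ.+-assoc (ℤ.+ 1) b (ℤ.+ (length zs ℕ.+ c)) ⟩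
    ℤ.+ 1 ℤ.+ (b ℤ.+ ℤ.+ (length zs ℕ.+ c))      ∎

-- Generating functions over subsets

^-+ : ∀ a m n → a ^ (m ℕ.+ n) ≡ (a ^ m) * (a ^ n)
^-+ a zero n = sym (*-identityˡ (a ^ n))
^-+ a (suc m) n = trans (cong (a *_) (^-+ a m n)) (assoc a (a ^ m) (a ^ n))
  where
  assoc : ∀ a b c → a * (b * c) ≡ a * b * c
  assoc = solve-∀ ℚ-ring

^-distrib-* : ∀ a b n → (a * b) ^ n ≡ (a ^ n) * (b ^ n)
^-distrib-* a b zero = refl
^-distrib-* a b (suc n) = trans (cong (a * b *_) (^-distrib-* a b n)) (interchange a b (a ^ n) (b ^ n))
  where
  interchange : ∀ a b c d → a * b * (c * d) ≡ a * c * (b * d)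
  interchange = solve-∀ ℚ-ring

fromℕ-+ : ∀ m n → fromℕ (m ℕ.+ n) ≡ fromℕ m + fromℕ n
fromℕ-+ zero n = sym (+-identityˡ (fromℕ n))
fromℕ-+ (suc m) n = begin
  fromℕ (suc (m ℕ.+ n))            ≡⟨ fromℕ-suc (m ℕ.+ n) ⟩
  1ℚ + fromℕ (m ℕ.+ n)             ≡⟨ cong (1ℚ +_) (fromℕ-+ m n) ⟩
  1ℚ + (fromℕ m + fromℕ n)         ≡⟨ assoc 1ℚ (fromℕ m) (fromℕ n) ⟩
  1ℚ + fromℕ m + fromℕ n           ≡⟨ cong (_+ fromℕ n) (fromℕ-suc m) ⟨
  fromℕ (suc m) + fromℕ n          ∎
  where
  assoc : ∀ a b c → a + (b + c) ≡ a + b + c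
  assoc = solve-∀ ℚ-ring

2ℚ : ℚ
2ℚ = 1ℚ + 1ℚ

2^≡fromℕ-suc : ∀ i → ∃ λ m → 2ℚ ^ i ≡ fromℕ (suc m)
2^≡fromℕ-suc zero = 0 , refl
2^≡fromℕ-suc (suc i) with m , e ← 2^≡fromℕ-suc i = m ℕ.+ suc m , (begin
  2ℚ * (2ℚ ^ i)                        ≡⟨ cong (2ℚ *_) e ⟩
  (1ℚ + 1ℚ) * fromℕ (suc m)            ≡⟨ double (fromℕ (suc m)) ⟩
  fromℕ (suc m) + fromℕ (suc m)        ≡⟨ fromℕ-+ (suc m) (suc m) ⟨
  fromℕ (suc m ℕ.+ suc m)              ∎)
  where
  double : ∀ a → (1ℚ + 1ℚ) * a ≡ a + a
  double = solve-∀ ℚ-ring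

-- With 2^i = m + 1 the number is 2m + 1, visibly a successor.
2^suc-1≢0 : ∀ i → 2ℚ ^ suc i - 1ℚ ≢ 0ℚ
2^suc-1≢0 i z with m , e ← 2^≡fromℕ-suc i = fromℕ-suc≢0 (m ℕ.+ m) (trans (begin
  fromℕ (suc m ℕ.+ m)                        ≡⟨ fromℕ-+ (suc m) m ⟩
  fromℕ (suc m) + fromℕ m                    ≡⟨ cong (_+ fromℕ m) (fromℕ-suc m) ⟩
  1ℚ + fromℕ m + fromℕ m                     ≡⟨ rearrange (fromℕ m) ⟩
  (1ℚ + 1ℚ) * (1ℚ + fromℕ m) - 1ℚ            ≡⟨ cong (λ f → (1ℚ + 1ℚ) * f - 1ℚ) (trans (sym (fromℕ-suc m)) (sym e)) ⟩
  2ℚ ^ suc i - 1ℚ                            ∎) z)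
  where
  rearrange : ∀ a → 1ℚ + a + a ≡ (1ℚ + 1ℚ) * (1ℚ + a) - 1ℚ
  rearrange = solve-∀ ℚ-ring

eval : ∀ {n} → (Fin n → ℚ) → ℚ → ℚ
eval c u = ΣF (λ i → c i * (u ^ toℕ i))

eval-tail : ∀ {n} (c : Fin (suc n) → ℚ) u → eval c u ≡ c zero + u * eval (c ∘ suc) u
eval-tail c u = cong₂ _+_ (unit (c zero))
  (trans (ΣF-cong (λ i → pull (c (suc i)) u (u ^ toℕ i))) (sym (*-distribˡ-ΣF u (λ i → c (suc i) * (u ^ toℕ i)))))
  where
  unit : ∀ a → a * 1ℚ ≡ a
  unit = solve-∀ ℚ-ring
  pull : ∀ c u p → c * (u * p) ≡ u * (c * p)
  pull = solve-∀ ℚ-ring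

-- p (2 u) - p u = u r u, where r has the coefficients (2^(i+1) - 1) c_(i+1).
coefficients-vanish : ∀ {n} (c : Fin n → ℚ) → (∀ u → u ≢ 0ℚ → eval c u ≡ 0ℚ) → ∀ i → c i ≡ 0ℚ
coefficients-vanish {suc n} c vanish = λ { zero → head-zero ; (suc i) → tail-zero i }
  where
  r : Fin n → ℚ
  r i = (2ℚ ^ suc (toℕ i) - 1ℚ) * c (suc i)
  r-vanish : ∀ u → u ≢ 0ℚ → eval r u ≡ 0ℚ
  -- The division by u makes r vanish only away from 0; this is why the lemma assumes vanishing at
  -- nonzero u alone.
  r-vanish u u≢0 = *-cancelʳ-≢0 u≢0 (begin
    eval r u * u
      ≡⟨ comm (eval r u) u ⟩
    u * eval r u
      ≡⟨ cong (u *_) (ΣF-cong (λ i → term (2ℚ ^ toℕ i) (c (suc i)) (u ^ toℕ i) ((2ℚ * u) ^ toℕ i) (^-distrib-* 2ℚ u (toℕ i)))) ⟩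
    u * ΣF (λ i → 2ℚ * (c (suc i) * ((2ℚ * u) ^ toℕ i)) + (- 1ℚ) * (c (suc i) * (u ^ toℕ i)))
      ≡⟨ cong (u *_) (trans (ΣF-+ (λ i → 2ℚ * (c (suc i) * ((2ℚ * u) ^ toℕ i))) (λ i → (- 1ℚ) * (c (suc i) * (u ^ toℕ i))))
          (cong₂ _+_ (sym (*-distribˡ-ΣF 2ℚ (λ i → c (suc i) * ((2ℚ * u) ^ toℕ i))))
                     (sym (*-distribˡ-ΣF (- 1ℚ) (λ i → c (suc i) * (u ^ toℕ i)))))) ⟩
    u * (2ℚ * eval (c ∘ suc) (2ℚ * u) + (- 1ℚ) * eval (c ∘ suc) u)
      ≡⟨ difference u 2ℚ (c zero) (eval (c ∘ suc) (2ℚ * u)) (eval (c ∘ suc) u) ⟩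
    c zero + 2ℚ * u * eval (c ∘ suc) (2ℚ * u) - (c zero + u * eval (c ∘ suc) u)
      ≡⟨ cong₂ _-_ (trans (sym (eval-tail c (2ℚ * u))) (vanish (2ℚ * u) (*-≢0 {2ℚ} {u} (λ ()) u≢0)))
                   (trans (sym (eval-tail c u)) (vanish u u≢0)) ⟩
    0ℚ - 0ℚ
      ≡⟨ *-zeroˡ u ⟨
    0ℚ * u ∎)
    where
    comm : ∀ a b → a * b ≡ b * a
    comm = solve-∀ ℚ-ring
    term : ∀ p c v w → w ≡ p * v → (2ℚ * p - 1ℚ) * c * v ≡ 2ℚ * (c * w) + (- 1ℚ) * (c * v)
    term p c v .(p * v) refl = expand 2ℚ p c v
      where
      expand : ∀ d p c v → (d * p - 1ℚ) * c * v ≡ d * (c * (p * v)) + (- 1ℚ) * (c * v)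
      expand = solve-∀ ℚ-ring
    difference : ∀ u d c e f → u * (d * e + (- 1ℚ) * f) ≡ c + d * u * e - (c + u * f)
    difference = solve-∀ ℚ-ring
  tail-zero : ∀ i → c (suc i) ≡ 0ℚ
  tail-zero i = *-cancelʳ-≢0 (2^suc-1≢0 (toℕ i)) (begin
    c (suc i) * (2ℚ ^ suc (toℕ i) - 1ℚ)      ≡⟨ comm (c (suc i)) (2ℚ ^ suc (toℕ i) - 1ℚ) ⟩
    r i                                      ≡⟨ coefficients-vanish r r-vanish i ⟩
    0ℚ                                       ≡⟨ *-zeroˡ (2ℚ ^ suc (toℕ i) - 1ℚ) ⟨
    0ℚ * (2ℚ ^ suc (toℕ i) - 1ℚ)             ∎)
    where
    comm : ∀ a b → a * b ≡ b * a
    comm = solve-∀ ℚ-ring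
  head-zero : c zero ≡ 0ℚ
  head-zero = begin
    c zero                                                ≡⟨ unit (c zero) ⟩
    c zero * 1ℚ + 0ℚ                                      ≡⟨ cong (c zero * 1ℚ +_) (ΣF-zero (λ i →
                                                               trans (cong (_* (1ℚ ^ suc (toℕ i))) (tail-zero i)) (*-zeroˡ (1ℚ ^ suc (toℕ i))))) ⟨
    eval c 1ℚ                                             ≡⟨ vanish 1ℚ (λ ()) ⟩
    0ℚ                                                    ∎
    where
    unit : ∀ a → a ≡ a * 1ℚ + 0ℚ
    unit = solve-∀ ℚ-ring

ΣF-select : ∀ {n} m (v : ℚ) (f : ℕ → ℚ) → m ℕ.< n → ΣF {n} (λ k → (if m ℕ.≡ᵇ toℕ k then v else 0ℚ) * f (toℕ k)) ≡ f m * v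
ΣF-select {suc n} zero v f _ = trans (cong (v * f 0 +_) (ΣF-zero {n} (λ k → *-zeroˡ (f (suc (toℕ k)))))) (drop v (f 0))
  where
  drop : ∀ a b → a * b + 0ℚ ≡ b * a
  drop = solve-∀ ℚ-ring
ΣF-select {suc n} (suc m) v f (ℕ.s≤s m<n) = trans (cong (0ℚ * f 0 +_) (ΣF-select {n} m v (f ∘ suc) m<n)) (drop (f 0) (f (suc m) * v))
  where
  drop : ∀ a b → 0ℚ * a + b ≡ b
  drop = solve-∀ ℚ-ring

-- Subsets are grouped by cardinality, which is at most n, so the sum is a polynomial in u with n +
-- 1 coefficients.
generating-function : ∀ n (φ : Subset n → ℚ) u →
  sumOver (allSubsets n) (λ I → (u ^ ∣ I ∣) * φ I) ≡ eval {suc n} (λ k → ΣSub n (toℕ k) φ) u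
generating-function n φ u = begin
  sumOver (allSubsets n) (λ I → (u ^ ∣ I ∣) * φ I)
    ≡⟨ sumOver-cong (allSubsets n) (λ I → sym (ΣF-select {suc n} ∣ I ∣ (φ I) (u ^_) (ℕ.s≤s (∣p∣≤n I)))) ⟩
  sumOver (allSubsets n) (λ I → ΣF {suc n} (λ k → select k I * (u ^ toℕ k)))
    ≡⟨ ΣF-sumOver-swap {n = suc n} (allSubsets n) (λ k I → select k I * (u ^ toℕ k)) ⟨
  ΣF {suc n} (λ k → sumOver (allSubsets n) (λ I → select k I * (u ^ toℕ k)))
    ≡⟨ ΣF-cong {suc n} (λ k → trans (sumOver-cong (allSubsets n) (λ I → comm (select k I) (u ^ toℕ k)))
         (trans (sym (*-distribˡ-sumOver (u ^ toℕ k) (allSubsets n) (select k))) (comm (u ^ toℕ k) (ΣSub n (toℕ k) φ)))) ⟩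
  eval {suc n} (λ k → ΣSub n (toℕ k) φ) u ∎
  where
  select : Fin (suc n) → Subset n → ℚ
  select k I = if ∣ I ∣ ℕ.≡ᵇ toℕ k then φ I else 0ℚ
  comm : ∀ a b → a * b ≡ b * a
  comm = solve-∀ ℚ-ring

-- Polynomials with equal values have equal coefficients; this recovers the identity for a single k
-- from the one summed with powers of u.
ΣSub-extract : ∀ n (φ ψ : Subset n → ℚ) →
  (∀ u → sumOver (allSubsets n) (λ I → (u ^ ∣ I ∣) * φ I) ≡ sumOver (allSubsets n) (λ I → (u ^ ∣ I ∣) * ψ I)) →
  ∀ {k} → k ℕ.≤ n → ΣSub n k φ ≡ ΣSub n k ψ
ΣSub-extract n φ ψ e {k} k≤n = subst (λ k → ΣSub n k φ ≡ ΣSub n k ψ) (toℕ-fromℕ< (ℕ.s≤s k≤n)) (begin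
  a i                     ≡⟨ split (a i) (b i) ⟩
  a i + (- 1ℚ) * b i + b i
    ≡⟨ cong (_+ b i) (coefficients-vanish {suc n} (λ k → a k + (- 1ℚ) * b k) (λ u _ → difference u) i) ⟩
  0ℚ + b i                ≡⟨ +-identityˡ (b i) ⟩
  b i                     ∎)
  where
  i : Fin (suc n)
  i = fromℕ< (ℕ.s≤s k≤n)
  a b : Fin (suc n) → ℚ
  a k = ΣSub n (toℕ k) φ
  b k = ΣSub n (toℕ k) ψ
  split : ∀ a b → a ≡ a + (- 1ℚ) * b + b
  split = solve-∀ ℚ-ring
  distrib : ∀ a b p → (a + (- 1ℚ) * b) * p ≡ a * p + (- 1ℚ) * (b * p)
  distrib = solve-∀ ℚ-ring
  cancel : ∀ a → a + (- 1ℚ) * a ≡ 0ℚ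
  cancel = solve-∀ ℚ-ring
  difference : ∀ u → eval {suc n} (λ k → a k + (- 1ℚ) * b k) u ≡ 0ℚ
  difference u = begin
    eval {suc n} (λ k → a k + (- 1ℚ) * b k) u
      ≡⟨ ΣF-cong {suc n} (λ k → distrib (a k) (b k) (u ^ toℕ k)) ⟩
    ΣF {suc n} (λ k → a k * (u ^ toℕ k) + (- 1ℚ) * (b k * (u ^ toℕ k)))
      ≡⟨ ΣF-+ {suc n} (λ k → a k * (u ^ toℕ k)) (λ k → (- 1ℚ) * (b k * (u ^ toℕ k))) ⟩
    eval a u + ΣF {suc n} (λ k → (- 1ℚ) * (b k * (u ^ toℕ k)))
      ≡⟨ cong (eval a u +_) (*-distribˡ-ΣF {suc n} (- 1ℚ) (λ k → b k * (u ^ toℕ k))) ⟨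
    eval a u + (- 1ℚ) * eval b u
      ≡⟨ cong (λ z → eval a u + (- 1ℚ) * z) (trans (sym (generating-function n ψ u)) (trans (sym (e u)) (generating-function n φ u))) ⟩
    eval a u + (- 1ℚ) * eval a u
      ≡⟨ cancel (eval a u) ⟩
    0ℚ ∎

ΣSub-cong : ∀ n k {φ ψ : Subset n → ℚ} → (∀ I → φ I ≡ ψ I) → ΣSub n k φ ≡ ΣSub n k ψ
ΣSub-cong n k e = sumOver-cong (allSubsets n) (λ I → cong (if ∣ I ∣ ℕ.≡ᵇ k then_else 0ℚ) (e I))

-- Only sets with k elements contribute, so a factor depending on k may be rewritten in terms of the
-- cardinality of I, the form needed by `AI-vandermonde`.
*-distribˡ-ΣSub : ∀ n k (g : ℕ → ℚ) (φ : Subset n → ℚ) → g k * ΣSub n k φ ≡ ΣSub n k (λ I → g ∣ I ∣ * φ I)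
*-distribˡ-ΣSub n k g φ = trans (*-distribˡ-sumOver (g k) (allSubsets n) _) (sumOver-cong (allSubsets n) pointwise)
  where
  pointwise : ∀ I → g k * (if ∣ I ∣ ℕ.≡ᵇ k then φ I else 0ℚ) ≡ (if ∣ I ∣ ℕ.≡ᵇ k then g ∣ I ∣ * φ I else 0ℚ)
  pointwise I with ∣ I ∣ ℕ.≡ᵇ k in eq
  ... | true = cong (λ l → g l * φ I) (sym (ℕ.≡ᵇ⇒≡ ∣ I ∣ k (subst T (sym eq) _)))
  ... | false = *-zeroʳ (g k)

-- Vandermonde products

crossFactor : ℚ → Side → Side → ℚ → ℚ → ℚ
crossFactor t inside outside a b = t * a - b
crossFactor t _ _ a b = 1ℚ

mutual
  -- The `factor` local to `RI` cannot be named; the open left-hand side is solved by the use in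
  -- `RI≡ΠF-crossFactor`.
  factor≡crossFactor : ∀ {n} (I : Subset n) t x i j → _ ≡ crossFactor t (lookup I i) (lookup I j) (x i) (x j)
  RI≡ΠF-crossFactor : ∀ {n} (I : Subset n) t x →
    RI I t x ≡ ΠF (λ i → ΠF (λ j → crossFactor t (lookup I i) (lookup I j) (x i) (x j)))
  RI≡ΠF-crossFactor I t x = ΠF-cong λ i → ΠF-cong λ j → factor≡crossFactor I t x i j
  factor≡crossFactor I t x i j with lookup I i | lookup I j
  ... | inside | inside = refl
  ... | inside | outside = refl
  ... | outside | inside = refl
  ... | outside | outside = refl

crossPair : ℚ → Side → Side → ℚ → ℚ → ℚ
crossPair t s s′ a b = crossFactor t s s′ a b * crossFactor t s′ s b a

-- Row 0 and column 0 of the double product are merged pair by pair, which matches the recursion of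
-- `vandermonde`.
RI-∷ : ∀ {n} s (I : Subset n) t (x : Fin (suc n) → ℚ) →
  RI (s ∷ I) t x ≡ ΠF (λ j → crossPair t s (lookup I j) (x zero) (x (suc j))) * RI I t (x ∘ suc)
RI-∷ s I t x = begin
  RI (s ∷ I) t x
    ≡⟨ RI≡ΠF-crossFactor (s ∷ I) t x ⟩
  crossFactor t s s (x zero) (x zero) * Row * ΠF (λ i → crossFactor t (lookup I i) s (x (suc i)) (x zero) * rest i)
    ≡⟨ cong₂ (λ d p → d * Row * p) (diagonal s) (ΠF-* (λ i → crossFactor t (lookup I i) s (x (suc i)) (x zero)) rest) ⟩
  1ℚ * Row * (Col * ΠF rest)
    ≡⟨ regroup Row Col (ΠF rest) ⟩
  Row * Col * ΠF rest
    ≡⟨ cong₂ _*_ (ΠF-* (λ j → crossFactor t s (lookup I j) (x zero) (x (suc j))) (λ j → crossFactor t (lookup I j) s (x (suc j)) (x zero)))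
                 (RI≡ΠF-crossFactor I t (x ∘ suc)) ⟨
  ΠF (λ j → crossPair t s (lookup I j) (x zero) (x (suc j))) * RI I t (x ∘ suc) ∎
  where
  Row Col : ℚ
  Row = ΠF (λ j → crossFactor t s (lookup I j) (x zero) (x (suc j)))
  Col = ΠF (λ i → crossFactor t (lookup I i) s (x (suc i)) (x zero))
  rest : Fin _ → ℚ
  rest i = ΠF (λ j → crossFactor t (lookup I i) (lookup I j) (x (suc i)) (x (suc j)))
  diagonal : ∀ s → crossFactor t s s (x zero) (x zero) ≡ 1ℚ
  diagonal inside = refl
  diagonal outside = refl
  regroup : ∀ a b c → 1ℚ * a * (b * c) ≡ a * b * c
  regroup = solve-∀ ℚ-ring

choose : ∀ {A : Set} {n} → Subset n → (Fin n → A) → (Fin n → A) → Fin n → A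
choose I a b i = if lookup I i then a i else b i

-- The binomial coefficient of k over 2 without division: a new element of I forms a pair with each
-- of the k earlier ones.
triangle : ℕ → ℕ
triangle zero = 0
triangle (suc k) = k ℕ.+ triangle k

triangle*2 : ∀ k → triangle k ℕ.* 2 ≡ k ℕ.* (k ℕ.∸ 1)
triangle*2 zero = refl
triangle*2 (suc zero) = refl
triangle*2 (suc (suc k)) = trans (ℕ.*-distribʳ-+ 2 (suc k) (triangle (suc k)))
  (trans (cong (suc k ℕ.* 2 ℕ.+_) (triangle*2 (suc k))) (arith k))
  where
  arith : ∀ k → suc k ℕ.* 2 ℕ.+ suc k ℕ.* k ≡ suc (suc k) ℕ.* suc k
  arith = ℕ-solve-∀

triangle≡binomial : ∀ k → k ℕ.* (k ℕ.∸ 1) ℕ./ 2 ≡ triangle k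
triangle≡binomial k = trans (cong (ℕ._/ 2) (sym (triangle*2 k))) (m*n/n≡m (triangle k) 2)

-- A pair i < j with both elements in I contributes a factor t.
jointFactor : ℚ → Side → Side → ℚ
jointFactor t s s′ = if s then (if s′ then t else 1ℚ) else 1ℚ

-- Compared pair by pair: two indices in I contribute t, two outside contribute nothing, and a mixed
-- pair exchanges a factor of `RI I 1ℚ x` for one of `RI I t x`. Denominators are cleared, so the
-- x_i may coincide.
vandermonde-choose : ∀ {n} (I : Subset n) t (x : Fin n → ℚ) →
  vandermonde (choose I (λ j → t * x j) x) * RI I 1ℚ x ≡ (t ^ triangle ∣ I ∣) * RI I t x * vandermonde x
vandermonde-choose [] t x = refl
vandermonde-choose {suc n} (s ∷ I) t x = begin
  ΠF (λ j → y zero - y (suc j)) * vandermonde (y ∘ suc) * RI (s ∷ I) 1ℚ x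
    ≡⟨ cong (ΠF (λ j → y zero - y (suc j)) * vandermonde (y ∘ suc) *_) (RI-∷ s I 1ℚ x) ⟩
  ΠF (λ j → y zero - y (suc j)) * vandermonde (y ∘ suc) * (ΠF (C 1ℚ) * RI I 1ℚ x′)
    ≡⟨ regroup₁ (ΠF (λ j → y zero - y (suc j))) (vandermonde (y ∘ suc)) (ΠF (C 1ℚ)) (RI I 1ℚ x′) ⟩
  ΠF (λ j → y zero - y (suc j)) * ΠF (C 1ℚ) * (vandermonde (y ∘ suc) * RI I 1ℚ x′)
    ≡⟨ cong₂ _*_ firstRow (vandermonde-choose I t x′) ⟩
  ΠF (λ j → jointFactor t s (lookup I j)) * ΠF (C t) * ΠF D * ((t ^ triangle ∣ I ∣) * RI I t x′ * vandermonde x′)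
    ≡⟨ regroup₂ (ΠF (λ j → jointFactor t s (lookup I j))) (ΠF (C t)) (ΠF D) (t ^ triangle ∣ I ∣) (RI I t x′) (vandermonde x′) ⟩
  ΠF (λ j → jointFactor t s (lookup I j)) * (t ^ triangle ∣ I ∣) * (ΠF (C t) * RI I t x′) * (ΠF D * vandermonde x′)
    ≡⟨ cong₂ (λ p r → p * r * (ΠF D * vandermonde x′)) (joint s) (sym (RI-∷ s I t x)) ⟩
  (t ^ triangle ∣ s ∷ I ∣) * RI (s ∷ I) t x * vandermonde x ∎
  where
  x′ : Fin n → ℚ
  x′ = x ∘ suc
  y : Fin (suc n) → ℚ
  y = choose (s ∷ I) (λ j → t * x j) x
  C : ℚ → Fin n → ℚ
  C v j = crossPair v s (lookup I j) (x zero) (x′ j)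
  D : Fin n → ℚ
  D j = x zero - x′ j
  regroup₁ : ∀ a b c d → a * b * (c * d) ≡ a * c * (b * d)
  regroup₁ = solve-∀ ℚ-ring
  regroup₂ : ∀ a b c d e f → a * b * c * (d * e * f) ≡ a * d * (b * e) * (c * f)
  regroup₂ = solve-∀ ℚ-ring
  pointwise : ∀ s s′ a b → ((if s then t * a else a) - (if s′ then t * b else b)) * crossPair 1ℚ s s′ a b ≡
    jointFactor t s s′ * crossPair t s s′ a b * (a - b)
  pointwise inside inside a b = ii t a b
    where
    ii : ∀ t a b → (t * a - t * b) * (1ℚ * 1ℚ) ≡ t * (1ℚ * 1ℚ) * (a - b)
    ii = solve-∀ ℚ-ring
  pointwise inside outside a b = io t a b
    where
    io : ∀ t a b → (t * a - b) * ((1ℚ * a - b) * 1ℚ) ≡ 1ℚ * ((t * a - b) * 1ℚ) * (a - b)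
    io = solve-∀ ℚ-ring
  pointwise outside inside a b = oi t a b
    where
    oi : ∀ t a b → (a - t * b) * (1ℚ * (1ℚ * b - a)) ≡ 1ℚ * (1ℚ * (t * b - a)) * (a - b)
    oi = solve-∀ ℚ-ring
  pointwise outside outside a b = oo a b
    where
    oo : ∀ a b → (a - b) * (1ℚ * 1ℚ) ≡ 1ℚ * (1ℚ * 1ℚ) * (a - b)
    oo = solve-∀ ℚ-ring
  firstRow : ΠF (λ j → y zero - y (suc j)) * ΠF (C 1ℚ) ≡ ΠF (λ j → jointFactor t s (lookup I j)) * ΠF (C t) * ΠF D
  firstRow = begin
    ΠF (λ j → y zero - y (suc j)) * ΠF (C 1ℚ)
      ≡⟨ ΠF-* (λ j → y zero - y (suc j)) (C 1ℚ) ⟨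
    ΠF (λ j → (y zero - y (suc j)) * C 1ℚ j)
      ≡⟨ ΠF-cong (λ j → pointwise s (lookup I j) (x zero) (x′ j)) ⟩
    ΠF (λ j → jointFactor t s (lookup I j) * C t j * D j)
      ≡⟨ ΠF-* (λ j → jointFactor t s (lookup I j) * C t j) D ⟩
    ΠF (λ j → jointFactor t s (lookup I j) * C t j) * ΠF D
      ≡⟨ cong (_* ΠF D) (ΠF-* (λ j → jointFactor t s (lookup I j)) (C t)) ⟩
    ΠF (λ j → jointFactor t s (lookup I j)) * ΠF (C t) * ΠF D ∎
  joint : ∀ s → ΠF (λ j → jointFactor t s (lookup I j)) * (t ^ triangle ∣ I ∣) ≡ t ^ triangle ∣ s ∷ I ∣
  -- Index 0 in I forms a pair with every element of the remaining set, giving a factor t for each.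
  joint inside = trans (cong (_* (t ^ triangle ∣ I ∣)) (weight-const t I)) (sym (^-+ t ∣ I ∣ (triangle ∣ I ∣)))
  joint outside = trans (cong (_* (t ^ triangle ∣ I ∣)) (ΠF-one n)) (*-identityˡ (t ^ triangle ∣ I ∣))
    where
    ΠF-one : ∀ n → ΠF {n} (λ _ → 1ℚ) ≡ 1ℚ
    ΠF-one zero = refl
    ΠF-one (suc n) = trans (*-identityˡ (ΠF {n} (λ _ → 1ℚ))) (ΠF-one n)

ΠF-≢0 : ∀ {n} {f : Fin n → ℚ} → (∀ i → f i ≢ 0ℚ) → ΠF f ≢ 0ℚ
ΠF-≢0 {zero} h = λ ()
ΠF-≢0 {suc n} h = *-≢0 (h zero) (ΠF-≢0 (h ∘ suc))

difference≢0 : ∀ {a b : ℚ} → a ≢ b → a - b ≢ 0ℚ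
difference≢0 {a} {b} a≢b e = a≢b (begin
  a            ≡⟨ split a b ⟩
  a - b + b    ≡⟨ cong (_+ b) e ⟩
  0ℚ + b       ≡⟨ +-identityˡ b ⟩
  b            ∎)
  where
  split : ∀ a b → a ≡ a - b + b
  split = solve-∀ ℚ-ring

vandermonde-≢0 : ∀ {n} (x : Fin n → ℚ) → (∀ i j → i ≢ j → x i ≢ x j) → vandermonde x ≢ 0ℚ
vandermonde-≢0 {zero} x distinct = λ ()
vandermonde-≢0 {suc n} x distinct = *-≢0 (ΠF-≢0 (λ j → difference≢0 (distinct zero (suc j) (λ ()))))
  (vandermonde-≢0 (x ∘ suc) (λ i j i≢j → distinct (suc i) (suc j) (i≢j ∘ suc-injective)))

RI-1-≢0 : ∀ {n} (I : Subset n) (x : Fin n → ℚ) → (∀ i j → i ≢ j → x i ≢ x j) → RI I 1ℚ x ≢ 0ℚ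
RI-1-≢0 I x distinct e = ΠF-≢0 (λ i → ΠF-≢0 (λ j → factor≢0 i j)) (trans (sym (RI≡ΠF-crossFactor I 1ℚ x)) e)
  where
  factor≢0 : ∀ i j → crossFactor 1ℚ (lookup I i) (lookup I j) (x i) (x j) ≢ 0ℚ
  factor≢0 i j with lookup I i in eᵢ | lookup I j in eⱼ
  ... | inside | inside = λ ()
  ... | outside | inside = λ ()
  ... | outside | outside = λ ()
  ... | inside | outside = difference≢0 (λ p → distinct i j i≢j (trans (sym (*-identityˡ (x i))) p))
    where
    i≢j : i ≢ j
    i≢j refl with () ← trans (sym eᵢ) eⱼ

AI-vandermonde : ∀ {n} (I : Subset n) t (x : Fin n → ℚ) → (∀ i j → i ≢ j → x i ≢ x j) →
  vandermonde (choose I (λ j → t * x j) x) ≡ (t ^ triangle ∣ I ∣) * AI I t x * vandermonde x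
AI-vandermonde I t x distinct = *-cancelʳ-≢0 R₁≢0 (begin
  vandermonde (choose I (λ j → t * x j) x) * RI I 1ℚ x              ≡⟨ vandermonde-choose I t x ⟩
  (t ^ triangle ∣ I ∣) * RI I t x * vandermonde x                   ≡⟨ cong (λ r → (t ^ triangle ∣ I ∣) * r * vandermonde x) (⊘-*-cancel (RI I t x) R₁≢0) ⟨
  (t ^ triangle ∣ I ∣) * (AI I t x * RI I 1ℚ x) * vandermonde x     ≡⟨ regroup (t ^ triangle ∣ I ∣) (AI I t x) (RI I 1ℚ x) (vandermonde x) ⟩
  (t ^ triangle ∣ I ∣) * AI I t x * vandermonde x * RI I 1ℚ x       ∎)
  where
  R₁≢0 : RI I 1ℚ x ≢ 0ℚ
  R₁≢0 = RI-1-≢0 I x distinct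
  regroup : ∀ a b c d → a * (b * c) * d ≡ a * b * d * c
  regroup = solve-∀ ℚ-ring

-- The kernel identity

tabulate-choose : ∀ {A : Set} {n} (I : Subset n) (a b : Fin n → A) →
  tabulate (choose I a b) ++ tabulate (choose I b a) ↭ tabulate a ++ tabulate b
tabulate-choose [] a b = ↭.refl
tabulate-choose {n = suc n} (inside ∷ I) a b = ↭.prep (a zero) (↭.↭-trans (shift (b zero) (tabulate (choose I (a ∘ suc) (b ∘ suc))) (tabulate (choose I (b ∘ suc) (a ∘ suc))))
  (↭.↭-trans (↭.prep (b zero) (tabulate-choose I (a ∘ suc) (b ∘ suc)))
    (↭.↭-sym (shift (b zero) (tabulate (a ∘ suc)) (tabulate (b ∘ suc))))))
tabulate-choose {n = suc n} (outside ∷ I) a b =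
  ↭.↭-trans (↭.prep (b zero) (shift (a zero) (tabulate (choose I (a ∘ suc) (b ∘ suc))) (tabulate (choose I (b ∘ suc) (a ∘ suc)))))
  (↭.↭-trans (↭.swap (b zero) (a zero) (tabulate-choose I (a ∘ suc) (b ∘ suc)))
    (↭.prep (a zero) (↭.↭-sym (shift (b zero) (tabulate (a ∘ suc)) (tabulate (b ∘ suc))))))

module _ {A : Set} {n} (a b : Fin (suc n) → A) (j : Fin (suc n)) where

  -- For a = x and b = t x these are the roots common to both summands after the change of basis.
  otherPairs : List A
  otherPairs = others a j ++ others b j

  others-++-tabulate : others a j ++ tabulate b ↭ b j ∷ otherPairs
  others-++-tabulate = ↭.↭-trans (++⁺ˡ (others a j) (tabulate-others b j)) (shift (b j) (others a j) (others b j))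

  tabulate-pairs : tabulate a ++ tabulate b ↭ a j ∷ b j ∷ otherPairs
  tabulate-pairs = ↭.↭-trans (++⁺ʳ (tabulate b) (tabulate-others a j)) (↭.prep (a j) others-++-tabulate)

-- Adding `choose I b a j` to either side gives all entries of a and b; then this entry is
-- cancelled.
others-choose : ∀ {A : Set} {n} (I : Subset (suc n)) (a b : Fin (suc n) → A) j →
  choose I a b j ∷ otherPairs a b j ↭ others (choose I b a) j ++ tabulate (choose I a b)
others-choose I a b j = ↭.↭-sym (drop-∷ {x = choose I b a j}
  (↭.↭-trans (++⁺ʳ (tabulate (choose I a b)) (↭.↭-sym (tabulate-others (choose I b a) j)))
  (↭.↭-trans (tabulate-choose I b a)
  (↭.↭-trans (++-comm (tabulate b) (tabulate a))
  (↭.↭-trans (tabulate-pairs a b j) exchange)))))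
  where
  exchange : a j ∷ b j ∷ otherPairs a b j ↭ choose I b a j ∷ choose I a b j ∷ otherPairs a b j
  exchange with lookup I j
  ... | inside = ↭.swap (a j) (b j) ↭.refl
  ... | outside = ↭.refl

kernel-identity : ∀ {m} (x : Fin (suc m) → ℚ) t u (G : Fin (suc m) → ℕ → ℚ) →
  let tx = λ j → t * x j in
  vandermonde x * sumOver (allSubsets (suc m)) (λ I → weight (λ c → u * (t ^ (m ℕ.∸ toℕ c))) I *
    det (λ c r → if lookup I c then opL (tabulate x) (G r) (toℕ c) else opL (tabulate tx) (G r) (toℕ c)))
  ≡ sumOver (allSubsets (suc m)) (λ I → weight (λ _ → u) I *
    (vandermonde (choose I tx x) * det (λ c r → opL (tabulate (choose I x tx)) (G r) (toℕ c))))
kernel-identity {m} x t u G = begin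
  vandermonde x * sumOver (allSubsets (suc m)) (λ I → weight (λ c → u * (t ^ (m ℕ.∸ toℕ c))) I *
    det (λ c r → if lookup I c then opL (tabulate x) (G r) (toℕ c) else opL (tabulate tx) (G r) (toℕ c)))
    -- Read backwards: the sum over I collapses to one determinant, whose row c holds the values of
    -- the functionals H at w^c.
    ≡⟨ cong (vandermonde x *_) (det-add-rows (λ c r → opL (tabulate tx) (G r) (toℕ c)) (λ c r → opL (tabulate x) (G r) (toℕ c)) (λ c → u * (t ^ (m ℕ.∸ toℕ c)))) ⟨
  vandermonde x * det (λ c r → opL (tabulate tx) (G r) (toℕ c) + u * (t ^ (m ℕ.∸ toℕ c)) * opL (tabulate x) (G r) (toℕ c))
    ≡⟨ cong (vandermonde x *_) (det-cong (λ c r → cong (opL (tabulate tx) (G r) (toℕ c) +_) (assoc u (t ^ (m ℕ.∸ toℕ c)) (opL (tabulate x) (G r) (toℕ c))))) ⟩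
  vandermonde x * det (monomialRows {suc m} H)
    ≡⟨ det-others x H ⟨
  det (λ j r → opL (others x j) (H r) 0)
    ≡⟨ det-cong entry ⟩
  det (λ j r → opL (tx j ∷ otherPairs x tx j) (G r) 0 + u * opL (x j ∷ otherPairs x tx j) (G r) 0)
    ≡⟨ det-add-rows (λ j r → opL (tx j ∷ otherPairs x tx j) (G r) 0) (λ j r → opL (x j ∷ otherPairs x tx j) (G r) 0) (λ _ → u) ⟩
  sumOver (allSubsets (suc m)) (λ I → weight (λ _ → u) I *
    det (λ j r → if lookup I j then opL (x j ∷ otherPairs x tx j) (G r) 0 else opL (tx j ∷ otherPairs x tx j) (G r) 0))
    -- For each I the basis is changed back to monomials, now with the nodes `choose I tx x`; the
    -- functionals have absorbed the factors with roots `choose I x tx`.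
    ≡⟨ sumOver-cong (allSubsets (suc m)) (λ I → cong (weight (λ _ → u) I *_) (trans (det-cong (mixed I))
         (det-others (choose I tx x) (λ r → opL (tabulate (choose I x tx)) (G r))))) ⟩
  sumOver (allSubsets (suc m)) (λ I → weight (λ _ → u) I *
    (vandermonde (choose I tx x) * det (λ c r → opL (tabulate (choose I x tx)) (G r) (toℕ c)))) ∎
  where
  tx : Fin (suc m) → ℚ
  tx j = t * x j
  H : Fin (suc m) → ℕ → ℚ
  -- The second summand is G r applied to u t^m f(w/t) ∏ (w - x_i) for f = w^c, where m = n - 1.
  H r c = opL (tabulate tx) (G r) c + u * ((t ^ (m ℕ.∸ c)) * opL (tabulate x) (G r) c)
  assoc : ∀ a b c → a * b * c ≡ a * (b * c)
  assoc = solve-∀ ℚ-ring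
  untwisted : ∀ j r → opL (others x j) (opL (tabulate tx) (G r)) 0 ≡ opL (tx j ∷ otherPairs x tx j) (G r) 0
  untwisted j r = trans (sym (opL-++ (others x j) (tabulate tx) (G r) 0)) (opL-↭ (others-++-tabulate x tx j) (G r) 0)
  twisted : ∀ j r → opL (others x j) (λ c → (t ^ (m ℕ.∸ c)) * opL (tabulate x) (G r) c) 0 ≡ opL (x j ∷ otherPairs x tx j) (G r) 0
  twisted j r = begin
    opL (others x j) (λ c → (t ^ (m ℕ.∸ c)) * opL (tabulate x) (G r) c) 0
      -- The list has length m, so the power of t left over is t^0.
      ≡⟨ opL-twist t m (others x j) (opL (tabulate x) (G r)) 0 (ℕ.≤-reflexive length-others) ⟩
    (t ^ (m ℕ.∸ length (others x j))) * opL (map (t *_) (others x j)) (opL (tabulate x) (G r)) 0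
      ≡⟨ cong₂ (λ e as → (t ^ e) * opL as (opL (tabulate x) (G r)) 0)
           (trans (cong (m ℕ.∸_) length-others) (ℕ.n∸n≡0 m)) (map-tabulate (x ∘ punchIn j) (t *_)) ⟩
    1ℚ * opL (others tx j) (opL (tabulate x) (G r)) 0
      ≡⟨ *-identityˡ (opL (others tx j) (opL (tabulate x) (G r)) 0) ⟩
    opL (others tx j) (opL (tabulate x) (G r)) 0
      ≡⟨ opL-++ (others tx j) (tabulate x) (G r) 0 ⟨
    opL (others tx j ++ tabulate x) (G r) 0
      ≡⟨ opL-↭ (↭.↭-trans (others-++-tabulate tx x j) (↭.prep (x j) (++-comm (others tx j) (others x j)))) (G r) 0 ⟩
    opL (x j ∷ otherPairs x tx j) (G r) 0 ∎
    where
    length-others : length (others x j) ≡ m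
    length-others = length-tabulate (x ∘ punchIn j)
  entry : ∀ j r → opL (others x j) (H r) 0 ≡ opL (tx j ∷ otherPairs x tx j) (G r) 0 + u * opL (x j ∷ otherPairs x tx j) (G r) 0
  entry j r = trans (opL-linear (others x j) (opL (tabulate tx) (G r)) (λ c → (t ^ (m ℕ.∸ c)) * opL (tabulate x) (G r) c) u 0)
    (cong₂ (λ y z → y + u * z) (untwisted j r) (twisted j r))
  mixed : ∀ I j r → (if lookup I j then opL (x j ∷ otherPairs x tx j) (G r) 0 else opL (tx j ∷ otherPairs x tx j) (G r) 0)
    ≡ opL (others (choose I tx x) j) (opL (tabulate (choose I x tx)) (G r)) 0
  mixed I j r = begin
    (if lookup I j then opL (x j ∷ otherPairs x tx j) (G r) 0 else opL (tx j ∷ otherPairs x tx j) (G r) 0)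
      ≡⟨ if-float (λ z → opL (z ∷ otherPairs x tx j) (G r) 0) (lookup I j) ⟨
    opL (choose I x tx j ∷ otherPairs x tx j) (G r) 0
      ≡⟨ opL-↭ (others-choose I x tx j) (G r) 0 ⟩
    opL (others (choose I tx x) j ++ tabulate (choose I x tx)) (G r) 0
      ≡⟨ opL-++ (others (choose I tx x) j) (tabulate (choose I x tx)) (G r) 0 ⟩
    opL (others (choose I tx x) j) (opL (tabulate (choose I x tx)) (G r)) 0 ∎

-- The functions term and sumN local to expI are recovered like upTo above.
mutual
  expHead : ∀ m (I : Subset (suc m)) → _≡_ {A = ℕ} _ _
  expTail : ∀ m (I : Subset (suc m)) → _≡_ {A = ℕ} _ _
  expI-solved : ∀ m (I : Subset (suc m)) → expI I ≡ expI I
  expI-solved m I with ℕ._+_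
  ... | plus = cong₂ plus (expHead m I) (expTail m I)
  expHead m I = refl
  expTail m I = refl

mutual
  termHandle : ∀ n (I : Subset n) (s : Side) (i : Fin n) → _≡_ {A = ℕ} _ _
  termHandle-solved : ∀ m (I : Subset (suc m)) → lhs (expHead m I) ≡ lhs (expHead m I)
  termHandle-solved m I with suc m | I | Fin.zero {m} | lookup I zero
  ... | w | J | z | l = termHandle w J l z
  termHandle n I s i = refl

mutual
  sumHandle : ∀ n (I : Subset n) m (f : Fin m → ℕ) → _≡_ {A = ℕ} _ _
  sumHandle-solved : ∀ m (I : Subset (suc m)) → lhs (expTail m I) ≡ lhs (expTail m I)
  sumHandle-solved m I with suc m | I | (λ i → lhs (termHandle (suc m) I (lookup I (suc i)) (suc i)))
  ... | w | J | f = sumHandle w J m f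
  sumHandle n I m f = refl

^-sumHandle : ∀ t n (I : Subset n) m (f : Fin m → ℕ) → t ^ lhs (sumHandle n I m f) ≡ ΠF (λ i → t ^ f i)
^-sumHandle t n I zero f = refl
^-sumHandle t n I (suc m) f = trans (^-+ t (f zero) (lhs (sumHandle n I m (f ∘ suc)))) (cong ((t ^ f zero) *_) (^-sumHandle t n I m (f ∘ suc)))

weight-expI : ∀ {m} t u (I : Subset (suc m)) → weight (λ c → u * (t ^ (m ℕ.∸ toℕ c))) I ≡ (u ^ ∣ I ∣) * (t ^ expI I)
weight-expI {m} t u I = begin
  weight (λ c → u * (t ^ (m ℕ.∸ toℕ c))) I
    ≡⟨ ΠF-cong (λ c → split (lookup I c) c) ⟩
  ΠF (λ c → (if lookup I c then u else 1ℚ) * (t ^ lhs (termHandle (suc m) I (lookup I c) c)))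
    ≡⟨ ΠF-* (λ c → if lookup I c then u else 1ℚ) (λ c → t ^ lhs (termHandle (suc m) I (lookup I c) c)) ⟩
  weight (λ _ → u) I * ΠF (λ c → t ^ lhs (termHandle (suc m) I (lookup I c) c))
    ≡⟨ cong₂ _*_ (weight-const u I) (sym (^-sumHandle t (suc m) I (suc m) (λ c → lhs (termHandle (suc m) I (lookup I c) c)))) ⟩
  (u ^ ∣ I ∣) * (t ^ expI I) ∎
  where
  split : ∀ s c → (if s then u * (t ^ (m ℕ.∸ toℕ c)) else 1ℚ) ≡ (if s then u else 1ℚ) * (t ^ lhs (termHandle (suc m) I s c))
  split inside c = refl
  split outside c = refl

-- The alphabets of the theorem and the conclusion

sumOver-tabulate : ∀ {n} {A : Set} (z : Fin n → A) (f : A → ℚ) → sumOver (tabulate z) f ≡ ΣF (f ∘ z)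
sumOver-tabulate {zero} z f = refl
sumOver-tabulate {suc n} z f = cong (f (z zero) +_) (sumOver-tabulate (z ∘ suc) f)

-- The alphabet X^{tq} + tX.
fullAlph : ∀ {n} → (Fin n → ℚ) → ℚ → ℚ → Alph
fullAlph x q t i = Xtq x q t i + ΣF (λ j → (t * x j) ^ i)

fullAlph-Xt : ∀ {n} (x : Fin n → ℚ) q t i → fullAlph x q t i ≡ (Xtq x q t ⊕ Xt x t) i + ΣF (λ j → x j ^ i)
fullAlph-Xt x q t i = begin
  Xtq x q t i + ΣF (λ j → (t * x j) ^ i)             ≡⟨ cong (Xtq x q t i +_) (trans (ΣF-cong (λ j → ^-distrib-* t (x j) i))
                                                          (sym (*-distribˡ-ΣF (t ^ i) (λ j → x j ^ i)))) ⟩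
  Xtq x q t i + (t ^ i) * pX x i                     ≡⟨ regroup (Xtq x q t i) (t ^ i) (pX x i) ⟩
  Xtq x q t i + pX x i * ((t ^ i) - 1ℚ) + pX x i     ∎
  where
  regroup : ∀ a b p → a + b * p ≡ a + p * (b - 1ℚ) + p
  regroup = solve-∀ ℚ-ring

-- Replacing x_i by q x_i adds (t - 1) x_i to X^{tq}. Taking x_i instead of t x_i among the removed
-- variables compensates for this. The comparison is made after multiplication by q^i - 1.
fullAlph-ΘI : ∀ {n} (x : Fin n → ℚ) q t (I : Subset n) i → q ^ i ≢ 1ℚ →
  fullAlph x q t i ≡ Xtq (ΘI I q x) q t i + ΣF (λ j → choose I x (λ j → t * x j) j ^ i)
fullAlph-ΘI x q t I i qⁱ≢1 = *-cancelʳ-≢0 d≢0 (begin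
  (Xtq x q t i + ΣF (λ j → (t * x j) ^ i)) * d
    ≡⟨ clear (pX x i) (ΣF (λ j → (t * x j) ^ i)) ⟩
  e * pX x i + d * ΣF (λ j → (t * x j) ^ i)
    ≡⟨ combine (λ j → x j ^ i) (λ j → (t * x j) ^ i) ⟩
  ΣF (λ j → e * (x j ^ i) + d * ((t * x j) ^ i))
    ≡⟨ ΣF-cong pointwise ⟩
  ΣF (λ j → e * (ΘI I q x j ^ i) + d * (choose I x (λ j → t * x j) j ^ i))
    ≡⟨ combine (λ j → ΘI I q x j ^ i) (λ j → choose I x (λ j → t * x j) j ^ i) ⟨
  e * pX (ΘI I q x) i + d * ΣF (λ j → choose I x (λ j → t * x j) j ^ i)
    ≡⟨ clear (pX (ΘI I q x) i) (ΣF (λ j → choose I x (λ j → t * x j) j ^ i)) ⟨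
  (Xtq (ΘI I q x) q t i + ΣF (λ j → choose I x (λ j → t * x j) j ^ i)) * d ∎)
  where
  d e : ℚ
  d = (q ^ i) - 1ℚ
  e = (t ^ i) - 1ℚ
  d≢0 : d ≢ 0ℚ
  d≢0 = difference≢0 qⁱ≢1
  clear : ∀ p s → ((p * e) ⊘ d + s) * d ≡ e * p + d * s
  clear p s = trans (distrib ((p * e) ⊘ d) s d) (trans (cong (_+ s * d) (⊘-*-cancel (p * e) d≢0)) (commute p e s d))
    where
    distrib : ∀ a s d → (a + s) * d ≡ a * d + s * d
    distrib = solve-∀ ℚ-ring
    commute : ∀ p e s d → p * e + s * d ≡ e * p + d * s
    commute = solve-∀ ℚ-ring
  combine : ∀ f g → e * ΣF f + d * ΣF g ≡ ΣF (λ j → e * f j + d * g j)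
  combine f g = trans (cong₂ _+_ (*-distribˡ-ΣF e f) (*-distribˡ-ΣF d g)) (sym (ΣF-+ (λ j → e * f j) (λ j → d * g j)))
  pointwise : ∀ j → e * (x j ^ i) + d * ((t * x j) ^ i) ≡ e * (ΘI I q x j ^ i) + d * (choose I x (λ j → t * x j) j ^ i)
  pointwise j with lookup I j
  ... | outside = refl
  ... | inside = begin
    e * (x j ^ i) + d * ((t * x j) ^ i)                ≡⟨ cong (λ p → e * (x j ^ i) + d * p) (^-distrib-* t (x j) i) ⟩
    e * (x j ^ i) + d * ((t ^ i) * (x j ^ i))          ≡⟨ exchange (t ^ i) (q ^ i) (x j ^ i) ⟩
    e * ((q ^ i) * (x j ^ i)) + d * (x j ^ i)          ≡⟨ cong (λ p → e * p + d * (x j ^ i)) (^-distrib-* q (x j) i) ⟨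
    e * ((q * x j) ^ i) + d * (x j ^ i)                ∎
    where
    exchange : ∀ t q x → (t - 1ℚ) * x + (q - 1ℚ) * (t * x) ≡ (t - 1ℚ) * (q * x) + (q - 1ℚ) * x
    exchange = solve-∀ ℚ-ring

module _ {m} (lam : Fin (suc m) → ℕ) (x : Fin (suc m) → ℚ) (q t : ℚ) where

  -- The index starts n lower than in the theorem, because removing n variables with `opL` raises it
  -- by n.
  hRow : Fin (suc m) → ℕ → ℚ
  hRow r c = Sℤ ((ℤ.+ lam r ℤ.- ℤ.+ toℕ r) ℤ.- ℤ.+ suc m ℤ.+ ℤ.+ c) (fullAlph x q t)

  -- The removed variables z decide which entry appears: x gives X^{tq} + X^t, t x gives X^{tq}, and
  -- the choice by I gives the alphabet of Θ_I.
  hRow-entry : ∀ (z : Fin (suc m) → ℚ) B → (∀ i → fullAlph x q t (suc i) ≡ B (suc i) + ΣF (λ j → z j ^ suc i)) →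
    ∀ r c → Sℤ (idx lam r c) B ≡ opL (tabulate z) (hRow r) (toℕ c)
  hRow-entry z B e r c = sym (trans
    (opL-S (tabulate z) (fullAlph x q t) B (λ i → trans (e i) (cong (B (suc i) +_) (sym (sumOver-tabulate z (_^ suc i))))) (base ℤ.- ℤ.+ suc m) (toℕ c))
    (cong (λ k → Sℤ k B) (begin
      base ℤ.- ℤ.+ suc m ℤ.+ ℤ.+ (length (tabulate z) ℕ.+ toℕ c)     ≡⟨ cong (λ l → base ℤ.- ℤ.+ suc m ℤ.+ ℤ.+ (l ℕ.+ toℕ c)) (length-tabulate z) ⟩
      base ℤ.- ℤ.+ suc m ℤ.+ (ℤ.+ suc m ℤ.+ ℤ.+ toℕ c)               ≡⟨ cancel base (ℤ.+ suc m) (ℤ.+ toℕ c) ⟩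
      base ℤ.+ ℤ.+ toℕ c                                             ∎)))
    where
    base : ℤ
    base = ℤ.+ lam r ℤ.- ℤ.+ toℕ r
    cancel : ∀ b n c → b ℤ.- n ℤ.+ (n ℤ.+ c) ≡ b ℤ.+ c
    cancel = ℤ-solve-∀

  det-DI : ∀ I → det (DI lam I x q t) ≡
    det (λ c r → if lookup I c then opL (tabulate x) (hRow r) (toℕ c) else opL (tabulate (λ j → t * x j)) (hRow r) (toℕ c))
  det-DI I = trans (det-transpose (DI lam I x q t)) (det-cong entry)
    where
    entry : ∀ c r → DI lam I x q t r c ≡
      (if lookup I c then opL (tabulate x) (hRow r) (toℕ c) else opL (tabulate (λ j → t * x j)) (hRow r) (toℕ c))
    entry c r with lookup I c
    ... | inside = hRow-entry x (Xtq x q t ⊕ Xt x t) (λ i → fullAlph-Xt x q t (suc i)) r c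
    ... | outside = hRow-entry (λ j → t * x j) (Xtq x q t) (λ i → refl) r c

  Schur-ΘI : (∀ i → q ^ suc i ≢ 1ℚ) → ∀ I → Schur lam (Xtq (ΘI I q x) q t) ≡
    det (λ c r → opL (tabulate (choose I x (λ j → t * x j))) (hRow r) (toℕ c))
  Schur-ΘI q≢1 I = trans (det-transpose (λ r c → Sℤ (idx lam r c) (Xtq (ΘI I q x) q t)))
    (det-cong (λ c r → hRow-entry (choose I x (λ j → t * x j)) (Xtq (ΘI I q x) q t) (λ i → fullAlph-ΘI x q t I (suc i) (q≢1 i)) r c))

  generating-identity : (∀ i → q ^ suc i ≢ 1ℚ) → ∀ u →
    sumOver (allSubsets (suc m)) (λ I → (u ^ ∣ I ∣) * (vandermonde x * ((t ^ expI I) * det (DI lam I x q t)))) ≡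
    sumOver (allSubsets (suc m)) (λ I → (u ^ ∣ I ∣) * (vandermonde (choose I (λ j → t * x j) x) * Schur lam (Xtq (ΘI I q x) q t)))
  generating-identity q≢1 u = begin
    sumOver (allSubsets (suc m)) (λ I → (u ^ ∣ I ∣) * (vandermonde x * ((t ^ expI I) * det (DI lam I x q t))))
      ≡⟨ sumOver-cong (allSubsets (suc m)) (λ I → trans (regroup (u ^ ∣ I ∣) (vandermonde x) (t ^ expI I) (det (DI lam I x q t)))
           (cong (vandermonde x *_) (cong₂ _*_ (sym (weight-expI t u I)) (det-DI I)))) ⟩
    sumOver (allSubsets (suc m)) (λ I → vandermonde x * left I)
      ≡⟨ *-distribˡ-sumOver (vandermonde x) (allSubsets (suc m)) left ⟨
    vandermonde x * sumOver (allSubsets (suc m)) left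
      ≡⟨ kernel-identity x t u hRow ⟩
    sumOver (allSubsets (suc m)) (λ I → weight (λ _ → u) I *
      (vandermonde (choose I (λ j → t * x j) x) * det (λ c r → opL (tabulate (choose I x (λ j → t * x j))) (hRow r) (toℕ c))))
      ≡⟨ sumOver-cong (allSubsets (suc m)) (λ I → cong₂ (λ w s → w * (vandermonde (choose I (λ j → t * x j) x) * s))
           (weight-const u I) (sym (Schur-ΘI q≢1 I))) ⟩
    sumOver (allSubsets (suc m)) (λ I → (u ^ ∣ I ∣) * (vandermonde (choose I (λ j → t * x j) x) * Schur lam (Xtq (ΘI I q x) q t))) ∎
    where
    left : Subset (suc m) → ℚ
    left I = weight (λ c → u * (t ^ (m ℕ.∸ toℕ c))) I *
      det (λ c r → if lookup I c then opL (tabulate x) (hRow r) (toℕ c) else opL (tabulate (λ j → t * x j)) (hRow r) (toℕ c))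
    regroup : ∀ u v t d → u * (v * (t * d)) ≡ v * (u * t * d)
    regroup = solve-∀ ℚ-ring

theorem2p1 : (n k : ℕ) → 1 ≤ n → 1 ≤ k → k ≤ n →
    (lam : Fin n → ℕ) → (∀ (i j : Fin n) → i Data.Fin.≤ j → lam j ≤ lam i) →
    (x : Fin n → ℚ) → (∀ (i j : Fin n) → i ≢ j → x i ≢ x j) → (q t : ℚ) → (∀ (i : ℕ) → q ^ suc i ≢ 1ℚ) →
    Mk n k q t (λ y → Schur lam (Xtq y q t)) x
    ≡ ΣSub n k (λ I → (t ^ expI I) * det (DI lam I x q t))
theorem2p1 n@(suc m) k 1≤n 1≤k k≤n lam decreasing x distinct q t q≢1 = *-cancelʳ-≢0 (vandermonde-≢0 x distinct) (begin
  -- Both sides are compared after multiplication by the Vandermonde product of x, which is nonzero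
  -- for distinct x_i.
  (t ^ (k ℕ.* (k ℕ.∸ 1) ℕ./ 2)) * ΣSub n k (λ I → AI I t x * F I) * vandermonde x
    ≡⟨ cong (λ e → (t ^ e) * ΣSub n k (λ I → AI I t x * F I) * vandermonde x) (triangle≡binomial k) ⟩
  (t ^ triangle k) * ΣSub n k (λ I → AI I t x * F I) * vandermonde x
    ≡⟨ comm ((t ^ triangle k) * ΣSub n k (λ I → AI I t x * F I)) (vandermonde x) ⟩
  vandermonde x * ((t ^ triangle k) * ΣSub n k (λ I → AI I t x * F I))
    ≡⟨ cong (vandermonde x *_) (*-distribˡ-ΣSub n k (λ l → t ^ triangle l) (λ I → AI I t x * F I)) ⟩
  vandermonde x * ΣSub n k (λ I → (t ^ triangle ∣ I ∣) * (AI I t x * F I))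
    ≡⟨ *-distribˡ-ΣSub n k (λ _ → vandermonde x) (λ I → (t ^ triangle ∣ I ∣) * (AI I t x * F I)) ⟩
  ΣSub n k (λ I → vandermonde x * ((t ^ triangle ∣ I ∣) * (AI I t x * F I)))
    -- The power of t and the coefficient of the operator together turn the Vandermonde product of x
    -- into that of the nodes chosen by I.
    ≡⟨ ΣSub-cong n k (λ I → trans (regroup (vandermonde x) (t ^ triangle ∣ I ∣) (AI I t x) (F I)) (cong (_* F I) (sym (AI-vandermonde I t x distinct)))) ⟩
  ΣSub n k (λ I → vandermonde (choose I (λ j → t * x j) x) * F I)
    -- Comparison of the coefficients of u^k.
    ≡⟨ ΣSub-extract n (λ I → vandermonde x * R I) (λ I → vandermonde (choose I (λ j → t * x j) x) * F I) (generating-identity lam x q t q≢1) k≤n ⟨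
  ΣSub n k (λ I → vandermonde x * R I)
    ≡⟨ *-distribˡ-ΣSub n k (λ _ → vandermonde x) R ⟨
  vandermonde x * ΣSub n k R
    ≡⟨ comm (vandermonde x) (ΣSub n k R) ⟩
  ΣSub n k R * vandermonde x ∎)
  where
  F R : Subset n → ℚ
  F I = Schur lam (Xtq (ΘI I q x) q t)
  R I = (t ^ expI I) * det (DI lam I x q t)
  comm : ∀ a b → a * b ≡ b * a
  comm = solve-∀ ℚ-ring
  regroup : ∀ v t a f → v * (t * (a * f)) ≡ t * a * v * f
  regroup = solve-∀ ℚ-ring
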